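{- The collection $\mathcal{QS}=\bigsqcup_{n\geq 1}\mathcal{QS}(n)$, equipped with the products $\circ_i:\mathcal{QS}(n)\times\mathcal{QS}(m)\to\mathcal{QS}(n+m-1)$ ($n,m\ge 1$, $1\le i\le n$) given in the context and with the unit $\mathbf{1}=(0)\in\mathcal{QS}(1)$, is a nonsymmetric SET quiddity-operad.
   Context: Write $[n]=\{1,\ldots,n\}$. Nonsymmetric SET quiddity-operad: a collection of sets $\mathcal{P}=\bigsqcup_{n\geq 1}\mathcal{P}(n)$ together with partial composition maps $\circ_{i}:\mathcal{P}(n)\times \mathcal{P}(m)\to \mathcal{P}(n+m-1)$ for $n,m\geq 1$, $i\in [n]$, and a distinguished element $\mathbf{1}\in \mathcal{P}(1)$ (the unit), such that for all $x\in\mathcal{P}(n)$, $y\in \mathcal{P}(m)$, $z\in\mathcal{P}(k)$: (1) $(x\circ_{i} y)\circ_{i+j-1} z=x\circ_{i}(y\circ_{j}z)$ for $i\in [n]$ and $j\in [m-1]$, where $m\ge 2$; (2) $(x\circ_{i} y)\circ_{j+m-1} z=(x\circ_{j} z)\circ_{i} y$ for $i,j\in [n]$ with $i<j$, where $n>1$; (3) $\mathbf{1}\circ_{1} x=x=x\circ_{i} \mathbf{1}$ for all $i\in[n]$. (In (1), the case $j=m$ is deliberately excluded.) The sets: for $n\ge 3$, consider a plane convex $n$-gon with vertices labeled counterclockwise by $1,\ldots,n$; the quiddity sequence of a triangulation is $(t_1,\ldots,t_n)$, where $t_i$ is the number of triangles incident with vertex $i$, and $\mathcal{QS}(n)$ is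 the set of all quiddity sequences of triangulations of the $n$-gon. Moreover $\mathcal{QS}(1)=\{(0)\}$ and $\mathcal{QS}(2)=\{(0,0)\}$. The products: (a) for $n,m\ge 3$, $\mathcal{T}=(t_1,\ldots,t_n)\in\mathcal{QS}(n)$, $\mathcal{S}=(s_1,\ldots,s_m)\in\mathcal{QS}(m)$: for $1\le i\le n-1$, $$\mathcal{T}\circ_{i}\mathcal{S}=(t_{1},\ldots,t_{i-1}, t_{i}+s_{1}+1,s_{2},\ldots,s_{m-1}, s_{m}+1, t_{i+1}+1,t_{i+2},\ldots,t_{n}),$$ and $\mathcal{T}\circ_{n}\mathcal{S}=(t_{1}+1,t_{2},\ldots,t_{n-1}, t_{n}+s_{1}+1,s_{2},\ldots,s_{m-1}, s_{m}+1)$; (b) for $n\geq 1$ and $i\in[n]$: $(0)\circ_{1}(t_{1},\ldots,t_{n})=(t_{1},\ldots,t_{n})\circ_{i}(0)=(t_{1},\ldots,t_{n})$; (c) for $n\ge 3$: $(t_{1},\ldots,t_{n})\circ_{i}(0,0)=(t_{1},\ldots,t_{i-1},t_{i}+1,1,t_{i+1}+1,t_{i+2},\ldots,t_{n})$ for $1\le i\le n-1$, and $(t_{1},\ldots,t_{n})\circ_{n}(0,0)=(t_{1}+1,t_{2},\ldots,t_{n-1},t_{n}+1,1)$; (d) for $n\ge 3$: $(0,0)\circ_{1}(t_{1},\ldots,t_{n})=(t_{1}+1,t_{2},\ldots,t_{n-1},t_{n}+1,1)$ and $(0,0)\circ_{2}(t_{1},\ldots,t_{n})=(1,t_{1}+1,t_{2},\ldots,t_{n-1},t_{n}+1)$;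 (e) $(0,0)\circ_{1}(0,0)=(0,0)\circ_{2}(0,0)=(1,1,1)$. -}

module Defs where

open import Data.Empty using (⊥)
open import Data.Fin using (Fin; zero; suc; toℕ; fromℕ; fromℕ<; inject₁; _↑ˡ_; _<_)
open import Data.Fin.Properties using (_≟_; _<?_; toℕ≤pred[n])
open import Data.Irrelevant as Irrelevant using (Irrelevant)
open import Data.List using (List; length; filter; allFin; cartesianProduct)
open import Data.List.Membership.Propositional using (_∈_)
import Data.List.Membership.DecPropositional as DecMembership
open import Data.Nat as ℕ using (ℕ; zero; suc; _+_; s≤s)
open import Data.Nat.DivMod using (_mod_)
open import Data.Nat.Properties using (+-comm; +-identityʳ; +-mono-≤)
open import Data.Product using (Σ; Σ-syntax; _×_; _,_)
open import Data.Product.Properties using (≡-dec)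
open import Data.Refinement using (Refinement; Refinement-syntax; _,_)
open import Data.Sum using (_⊎_)
open import Data.Vec using (Vec; []; _∷_; _++_; _∷ʳ_; _[_]%=_; cast; tabulate)
open import Level using (Level)
open import Relation.Binary.PropositionalEquality using (_≡_; refl; cong; sym)
open import Relation.Nullary using (¬_; Dec)
open import Relation.Nullary.Decidable using (_×-dec_; _⊎-dec_)

-- Positions are elements of Fin, so everything below is 0-based: the one-based
-- index i + j - 1 is the 0-based index i + j.

infixl 6 _⊕_

_⊕_ : ∀ {n m} → Fin (suc n) → Fin (suc m) → Fin (suc (n + m))
i ⊕ j = fromℕ< {toℕ i + toℕ j} (s≤s (+-mono-≤ (toℕ≤pred[n] i) (toℕ≤pred[n] j)))

-- Only the components P (suc n) are used, so P 0 plays no role.  The two sides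
-- of each axiom live in arities that agree only propositionally; they are
-- compared as elements of the disjoint union Σ ℕ P.

record IsQuiddityOperad
  {ℓ : Level} (P : ℕ → Set ℓ)
  (_∘⟨_⟩_ : ∀ {n m} → P (suc n) → Fin (suc n) → P (suc m) → P (suc (n + m)))
  (𝟏 : P 1) : Set ℓ where

  infix 4 _≋_

  _≋_ : ∀ {a b} → P a → P b → Set ℓ
  _≋_ {a} {b} x y = _≡_ {A = Σ ℕ P} (a , x) (b , y)

  field
    -- inject₁ j ranges over all positions of y except the last one.
    sequential : ∀ {n m k} (x : P (suc n)) (y : P (suc (suc m))) (z : P (suc k))
      (i : Fin (suc n)) (j : Fin (suc m)) →
      (x ∘⟨ i ⟩ y) ∘⟨ i ⊕ inject₁ j ⟩ z ≋ x ∘⟨ i ⟩ (y ∘⟨ inject₁ j ⟩ z)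

    -- y has arity suc m, so the one-based j + arity y - 1 is j ⊕ fromℕ m.
    parallel : ∀ {n m k} (x : P (suc n)) (y : P (suc m)) (z : P (suc k))
      (i j : Fin (suc n)) → i < j →
      (x ∘⟨ i ⟩ y) ∘⟨ j ⊕ fromℕ m ⟩ z ≋ (x ∘⟨ j ⟩ z) ∘⟨ i ↑ˡ k ⟩ y

    identityˡ : ∀ {n} (x : P (suc n)) → 𝟏 ∘⟨ zero ⟩ x ≋ x

    identityʳ : ∀ {n} (x : P (suc n)) (i : Fin (suc n)) → x ∘⟨ i ⟩ 𝟏 ≋ x

-- The vertices of the convex n-gon are Fin n in counterclockwise order.  A chord
-- is the pair of its endpoints, the smaller one first.

Chord : ℕ → Set
Chord n = Fin n × Fin n

IsSide : ∀ {n} → Chord n → Set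
IsSide {n} (a , b) = suc (toℕ a) ≡ toℕ b ⊎ (toℕ a ≡ 0 × suc (toℕ b) ≡ n)

isSide? : ∀ {n} (e : Chord n) → Dec (IsSide e)
isSide? {n} (a , b) =
  (suc (toℕ a) ℕ.≟ toℕ b) ⊎-dec ((toℕ a ℕ.≟ 0) ×-dec (suc (toℕ b) ℕ.≟ n))

IsDiagonal : ∀ {n} → Chord n → Set
IsDiagonal e@(a , b) = a < b × ¬ IsSide e

-- By convexity, two diagonals meet in an interior point exactly when their
-- endpoints are distinct and interleave.
Crosses : ∀ {n} → Chord n → Chord n → Set
Crosses (a , b) (c , d) = (a < c × c < b × b < d) ⊎ (c < a × a < d × d < b)

-- A triangulation is a maximal set of pairwise noncrossing diagonals.  The list
-- represents a finite set: order and repetitions are never observed.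
record Triangulation (n : ℕ) : Set where
  field
    diagonals   : List (Chord n)
    isDiagonal  : ∀ {e} → e ∈ diagonals → IsDiagonal e
    noncrossing : ∀ {e f} → e ∈ diagonals → f ∈ diagonals → ¬ Crosses e f
    maximal     : ∀ {e} → IsDiagonal e →
                  (∀ {f} → f ∈ diagonals → ¬ Crosses e f) → e ∈ diagonals

Triple : ℕ → Set
Triple n = Fin n × Fin n × Fin n

module _ {n : ℕ} (Θ : Triangulation n) where
  open Triangulation Θ
  open DecMembership (≡-dec (_≟_ {n}) (_≟_ {n})) using (_∈?_)

  IsEdge : Chord n → Set
  IsEdge e = IsSide e ⊎ e ∈ diagonals

  isEdge? : (e : Chord n) → Dec (IsEdge e)
  isEdge? e = isSide? e ⊎-dec (e ∈? diagonals)

  -- The polygon being convex, a diagonal through the interior of such a triangle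
  -- would cross one of its edges, so these are exactly the triangles into which
  -- the diagonals cut the polygon.
  IsTriangle : Triple n → Set
  IsTriangle (a , b , c) =
    a < b × b < c × IsEdge (a , b) × IsEdge (b , c) × IsEdge (a , c)

  isTriangle? : (Δ : Triple n) → Dec (IsTriangle Δ)
  isTriangle? (a , b , c) =
    (a <? b) ×-dec (b <? c) ×-dec
    isEdge? (a , b) ×-dec isEdge? (b , c) ×-dec isEdge? (a , c)

Incident : ∀ {n} → Fin n → Triple n → Set
Incident v (a , b , c) = v ≡ a ⊎ v ≡ b ⊎ v ≡ c

incident? : ∀ {n} (v : Fin n) (Δ : Triple n) → Dec (Incident v Δ)
incident? v (a , b , c) = (v ≟ a) ⊎-dec (v ≟ b) ⊎-dec (v ≟ c)

triples : ∀ n → List (Triple n)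
triples n = cartesianProduct (allFin n) (cartesianProduct (allFin n) (allFin n))

quiddity : ∀ {n} → Triangulation n → Vec ℕ n
quiddity {n} Θ = tabulate λ v →
  length (filter (λ Δ → isTriangle? Θ Δ ×-dec incident? v Δ) (triples n))

IsQuiddity : ∀ {n} → Vec ℕ n → Set
IsQuiddity {0} t = ⊥
IsQuiddity {1} t = t ≡ 0 ∷ []
IsQuiddity {2} t = t ≡ 0 ∷ 0 ∷ []
IsQuiddity {n@(suc (suc (suc _)))} t = Σ[ Θ ∈ Triangulation n ] quiddity Θ ≡ t

-- The membership proof is irrelevant, so equality in QS n is equality of
-- sequences.
QS : ℕ → Set
QS n = [ t ∈ Vec ℕ n ∣ IsQuiddity t ]

𝟏 : QS 1
𝟏 = 0 ∷ [] , Irrelevant.[ refl ]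

insertAfter : ∀ {n m} → Vec ℕ (suc n) → Fin (suc n) → Vec ℕ m → Vec ℕ (suc (n + m))
insertAfter {n} {m} (x ∷ xs) zero ys = cast (cong suc (+-comm m n)) (x ∷ ys ++ xs)
insertAfter {suc n} (x ∷ xs) (suc i) ys = x ∷ insertAfter xs i ys

next : ∀ {n} → Fin (suc n) → Fin (suc n)
next {n} i = suc (toℕ i) mod suc n

-- On sequences from QS the arguments ignored below are (0) or (0,0).  In the last
-- two clauses the cyclic successor treats the positions i < n and i = n at once:
-- the entry after position i is increased by 1, and after the last position this
-- is the first entry.
graft : ∀ {n m} → Vec ℕ (suc n) → Fin (suc n) → Vec ℕ (suc m) → Vec ℕ (suc (n + m))
graft {zero} _ _ s = s
graft {suc n} {zero} t _ _ = cast (cong suc (sym (+-identityʳ (suc n)))) t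
graft {1} {1} _ _ _ = 1 ∷ 1 ∷ 1 ∷ []
graft {1} {suc (suc m)} _ zero s =
  (s [ zero ]%= suc [ fromℕ (suc (suc m)) ]%= suc) ∷ʳ 1
graft {1} {suc (suc m)} _ (suc zero) s =
  1 ∷ (s [ zero ]%= suc [ fromℕ (suc (suc m)) ]%= suc)
graft {suc (suc n)} {1} t i _ =
  insertAfter (t [ i ]%= suc [ next i ]%= suc) i (1 ∷ [])
graft {suc (suc n)} {suc (suc m)} t i (s₁ ∷ s) =
  insertAfter (t [ i ]%= (λ tᵢ → tᵢ + s₁ + 1) [ next i ]%= suc) i
    (s [ fromℕ (suc m) ]%= suc)

GraftClosed : Set
GraftClosed = ∀ {n m} (t : Vec ℕ (suc n)) (i : Fin (suc n)) (s : Vec ℕ (suc m)) →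
  IsQuiddity t → IsQuiddity s → IsQuiddity (graft t i s)

graftQS : GraftClosed →
  ∀ {n m} → QS (suc n) → Fin (suc n) → QS (suc m) → QS (suc (n + m))
graftQS closed (t , p) i (s , q) =
  graft t i s , Irrelevant.zipWith (closed t i s) p q

{-# OPTIONS --safe #-}
module Submission where

open import Data.Empty using (⊥-elim)
open import Data.Fin using (Fin; zero; suc; toℕ; fromℕ; fromℕ<; inject₁; punchIn; punchOut; _↑ˡ_; _<_; _≤_)
open import Data.Fin.Properties as Fin
  using (_≟_; _<?_; any?; toℕ-inject₁; toℕ-injective; toℕ<n; toℕ-fromℕ; toℕ-fromℕ<; toℕ-↑ˡ; toℕ≤pred[n];
         punchIn-punchOut; punchIn-mono-≤; punchIn-cancel-≤; punchInᵢ≢i; punchIn-injective)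
open import Data.Irrelevant using ([_])
open import Data.List using (List; []; _∷_; _++_; length; filter; map; allFin; cartesianProduct)
open import Data.List.Membership.Propositional using (_∈_)
open import Data.List.Membership.Propositional.Properties
  using (∈-filter⁺; ∈-filter⁻; ∈-cartesianProduct⁺; ∈-allFin; ∈-map⁺; ∈-map⁻)
open import Data.List.Membership.Propositional.Properties.WithK using (unique∧set⇒bag)
open import Data.List.Properties using (++-assoc; ++-identityʳ; length-++; filter-accept; filter-reject; filter-none)
open import Data.List.Relation.Binary.BagAndSetEquality using (∼bag⇒↭)
open import Data.List.Relation.Binary.Permutation.Propositional using (_↭_)
open import Data.List.Relation.Binary.Permutation.Propositional.Properties using (↭-length; filter-↭)
open import Data.List.Relation.Unary.All as All using ()
import Data.List.Relation.Unary.All.Properties as All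
open import Data.List.Relation.Unary.Any using (here; there)
open import Data.List.Relation.Unary.Unique.Propositional using (Unique; _∷_)
import Data.List.Relation.Unary.Unique.Propositional.Properties as Unique
open import Data.Nat as ℕ using (ℕ; zero; suc; _+_; z≤n; s≤s)
open import Data.Nat.DivMod using (_%_; m<n⇒m%n≡m; n%n≡0)
open import Data.Nat.Properties as ℕ using (+-assoc; +-comm; +-suc)
open import Data.Nat.Tactic.RingSolver using (solve-∀)
open import Data.Product using (Σ; Σ-syntax; ∃-syntax; _×_; _,_; proj₁; proj₂)
open import Data.Refinement using (value; _,_)
open import Data.Sum as Sum using (_⊎_; inj₁; inj₂)
open import Data.Vec as Vec using (Vec; []; _∷_; lookup; tabulate; toList; cast; _[_]%=_; _∷ʳ_)
open import Data.Vec.Properties as Vec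
  using (lookup∘tabulate; length-toList; toList-injective; toList-cast; toList-++; toList-∷ʳ; cast-is-id)
open import Function using (_∘_; id; _⇔_; mk⇔; Equivalence)
open import Relation.Binary.PropositionalEquality
open import Relation.Nullary using (¬_; Dec; yes; no; contradiction; recompute)
open import Relation.Nullary.Decidable using (_×-dec_; _⊎-dec_; ¬?)
open import Defs

open ≡-Reasoning

-- A sequence of length at least 2 is a quiddity sequence exactly when it arises
-- from (0,0) by inserting ears at interior gaps: every triangulation with at least
-- three vertices has an ear whose tip is neither the first nor the last vertex, and
-- cutting off or gluing on an ear changes the triangle counts only at its three
-- vertices.  Inserting an ear is grafting (0,0), so closure under all grafts follows
-- by induction from the operad identities, which are identities between lists.

-- Grafting on lists

-- The digon is not degenerate on lists: `cyclicSplice` with `digon` as either argument already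
-- gives the products with (0,0). One formula thus covers all sequences of length at least 2, and
-- only (0) is treated apart. Geometrically, it glues a triangle onto one side of each of the two
-- polygons, which share a vertex. The obstacle is the cut between the last and the first vertex,
-- across which an increment may land. It is isolated as an `incHead` outside a linear `splice`,
-- with which it commutes. The same cut is why ears sit at inner gaps, where base and tip have
-- consecutive labels; an ear at the last gap has to be reduced to these. Lists carry the identities
-- because the two sides have arities that agree only up to proof.

incHead : List ℕ → List ℕ
incHead []      = []
incHead (x ∷ l) = suc x ∷ l

incLast : List ℕ → List ℕ
incLast []          = []
incLast (x ∷ [])    = suc x ∷ []
incLast (x ∷ y ∷ l) = x ∷ incLast (y ∷ l)

-- Grafting without wrap-around: at the last position, the final increment has no
-- entry to act on and is dropped.
splice : List ℕ → ℕ → List ℕ → List ℕ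
splice []      _       _       = []
splice (a ∷ t) zero    []      = a ∷ t
splice (a ∷ t) zero    (b ∷ s) = a + b + 1 ∷ incLast s ++ incHead t
splice (a ∷ t) (suc i) s       = a ∷ splice t i s

-- At the last position, the final increment acts on the first entry.
cyclicSplice : List ℕ → ℕ → List ℕ → List ℕ
cyclicSplice t i s with suc i ℕ.≟ length t
... | yes _ = incHead (splice t i s)
... | no  _ = splice t i s

cyclicSplice-last : ∀ t i s → suc i ≡ length t → cyclicSplice t i s ≡ incHead (splice t i s)
cyclicSplice-last t i s p with suc i ℕ.≟ length t
... | yes _ = refl
... | no ¬p = ⊥-elim (¬p p)

cyclicSplice-inner : ∀ t i s → suc i ℕ.< length t → cyclicSplice t i s ≡ splice t i s
cyclicSplice-inner t i s p with suc i ℕ.≟ length t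
... | yes q = ⊥-elim (ℕ.<⇒≢ p q)
... | no _  = refl

length-incHead : ∀ l → length (incHead l) ≡ length l
length-incHead []      = refl
length-incHead (_ ∷ _) = refl

length-incLast : ∀ l → length (incLast l) ≡ length l
length-incLast []          = refl
length-incLast (x ∷ [])    = refl
length-incLast (x ∷ y ∷ l) = cong suc (length-incLast (y ∷ l))

length-splice : ∀ t i b s → i ℕ.< length t → length (splice t i (b ∷ s)) ≡ length t + length s
length-splice (a ∷ t) zero b s _ = cong suc (begin
  length (incLast s ++ incHead t)         ≡⟨ length-++ (incLast s) ⟩
  length (incLast s) + length (incHead t) ≡⟨ cong₂ _+_ (length-incLast s) (length-incHead t) ⟩
  length s + length t                     ≡⟨ +-comm (length s) _ ⟩
  length t + length s                     ∎)
length-splice (a ∷ t) (suc i) b s (s≤s i<) = cong suc (length-splice t i b s i<)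

length-cyclicSplice : ∀ t i b s → i ℕ.< length t →
  length (cyclicSplice t i (b ∷ s)) ≡ length t + length s
length-cyclicSplice t i b s i< with suc i ℕ.≟ length t
... | yes _ = trans (length-incHead (splice t i (b ∷ s))) (length-splice t i b s i<)
... | no  _ = length-splice t i b s i<

-- The first entry of `t` stays first under `splice`, and all that happens to it is addition. This
-- lets the wrapped increment be pulled out of every cyclic identity.
splice-incHead : ∀ t i s → splice (incHead t) i s ≡ incHead (splice t i s)
splice-incHead []      _       _       = refl
splice-incHead (_ ∷ _) zero    []      = refl
splice-incHead (_ ∷ _) zero    (_ ∷ _) = refl
splice-incHead (_ ∷ _) (suc _) _       = refl

incLast-++-∷ : ∀ l a t → incLast (l ++ a ∷ t) ≡ l ++ incLast (a ∷ t)
incLast-++-∷ []          a t = refl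
incLast-++-∷ (x ∷ [])    a t = refl
incLast-++-∷ (x ∷ y ∷ l) a t = cong (x ∷_) (incLast-++-∷ (y ∷ l) a t)

incHead-incLast-++ : ∀ a s r → incHead (incLast (a ∷ s) ++ r) ≡ incLast (suc a ∷ s) ++ r
incHead-incLast-++ a []      r = refl
incHead-incLast-++ a (_ ∷ s) r = refl

-- Away from the last position, the last entry of `t` remains the last entry of the result, so the
-- increments commute and `r` is out of reach. At the last position the increment would hit the
-- contact entry on one side and the end of `s` on the other.
splice-incLast : ∀ t i s r → suc i ℕ.< length t →
  splice (incLast t ++ r) i s ≡ incLast (splice t i s) ++ r
splice-incLast (a ∷ []) zero    []      r (s≤s ())
splice-incLast (a ∷ []) zero    (b ∷ s) r (s≤s ())
splice-incLast (a ∷ c ∷ t) zero []      r _ = refl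
splice-incLast (a ∷ c ∷ t) zero (b ∷ s) r _ = begin
  a + b + 1 ∷ incLast s ++ incHead (incLast (c ∷ t) ++ r)
    ≡⟨ cong (λ u → a + b + 1 ∷ incLast s ++ u) (incHead-incLast-++ c t r) ⟩
  a + b + 1 ∷ incLast s ++ incLast (suc c ∷ t) ++ r
    ≡⟨ cong (a + b + 1 ∷_) (++-assoc (incLast s) _ r) ⟨
  (a + b + 1 ∷ incLast s ++ incLast (suc c ∷ t)) ++ r
    ≡⟨ cong (_++ r) (incLast-++-∷ (a + b + 1 ∷ incLast s) (suc c) t) ⟨
  incLast (a + b + 1 ∷ incLast s ++ suc c ∷ t) ++ r ∎
splice-incLast (a ∷ c ∷ [])    (suc i) s r (s≤s (s≤s ()))
splice-incLast (a ∷ c ∷ d ∷ t) (suc zero) [] r i< = refl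
splice-incLast (a ∷ c ∷ d ∷ t) (suc zero) (b ∷ s) r (s≤s i<) =
  cong (a ∷_) (splice-incLast (c ∷ d ∷ t) zero (b ∷ s) r i<)
splice-incLast (a ∷ c ∷ d ∷ t) (suc (suc i)) s r (s≤s i<) =
  cong (a ∷_) (splice-incLast (c ∷ d ∷ t) (suc i) s r i<)

splice-skip : ∀ p t j s → splice (p ++ t) (j + length p) s ≡ p ++ splice t j s
splice-skip []      t j s = cong (λ k → splice t k s) (ℕ.+-identityʳ j)
splice-skip (x ∷ p) t j s rewrite +-suc j (length p) = cong (x ∷_) (splice-skip p t j s)

entry-assoc : ∀ a b c → a + b + 1 + c + 1 ≡ a + (b + c + 1) + 1
entry-assoc = solve-∀

-- If `j` is zero, all three sequences meet in one entry, settled by `entry-assoc`; a later `j` is a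
-- matter of `splice-incLast`. The bound excludes the last entry of `y`: there, the trailing
-- increment from `z` would fall on the next entry of `t` in one order of grafting and be dropped in
-- the other.
splice-sequential : ∀ t i y j z → suc j ℕ.< length y →
  splice (splice t i y) (i + j) z ≡ splice t i (splice y j z)
splice-sequential []      i       y j z _ = refl
splice-sequential (a ∷ t) (suc i) y j z j< = cong (a ∷_) (splice-sequential t i y j z j<)
splice-sequential (a ∷ t) zero (b ∷ d ∷ y) zero    []      _ = refl
splice-sequential (a ∷ t) zero (b ∷ d ∷ y) zero    (c ∷ z) _ = cong₂ _∷_ (entry-assoc a b c) (begin
  incLast z ++ incHead (incLast (d ∷ y) ++ incHead t)
    ≡⟨ cong (incLast z ++_) (incHead-incLast-++ d y (incHead t)) ⟩
  incLast z ++ incLast (suc d ∷ y) ++ incHead t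
    ≡⟨ ++-assoc (incLast z) _ _ ⟨
  (incLast z ++ incLast (suc d ∷ y)) ++ incHead t
    ≡⟨ cong (_++ incHead t) (incLast-++-∷ (incLast z) (suc d) y) ⟨
  incLast (incLast z ++ suc d ∷ y) ++ incHead t ∎)
splice-sequential (a ∷ t) zero (b ∷ y) (suc j) z (s≤s j<) =
  cong (a + b + 1 ∷_) (splice-incLast y j z (incHead t) j<)

-- The head `b` merges into the entry at `i`, so later positions move by `length y`. The grafts
-- interact only when `j` is `suc i`, where both add to the same entry; there `splice-incHead`
-- applies.
splice-parallel : ∀ t i j b y z → i ℕ.< j →
  splice (splice t i (b ∷ y)) (j + length y) z ≡ splice (splice t j z) i (b ∷ y)
splice-parallel []      i       j       b y z _ = refl
splice-parallel (a ∷ t) zero    (suc j) b y z _ = cong (a + b + 1 ∷_) (begin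
  splice (incLast y ++ incHead t) (j + length y) z
    ≡⟨ cong (λ k → splice (incLast y ++ incHead t) (j + k) z) (length-incLast y) ⟨
  splice (incLast y ++ incHead t) (j + length (incLast y)) z
    ≡⟨ splice-skip (incLast y) (incHead t) j z ⟩
  incLast y ++ splice (incHead t) j z
    ≡⟨ cong (incLast y ++_) (splice-incHead t j z) ⟩
  incLast y ++ incHead (splice t j z) ∎)
splice-parallel (a ∷ t) (suc i) (suc j) b y z (s≤s i<j) =
  cong (a ∷_) (splice-parallel t i j b y z i<j)

-- Since `j` is not last in `b ∷ y`, position `i + j` is not last in the graft, so inserting `z`
-- never wraps around. The only possible wrap comes from grafting into `t`, and its `incHead`
-- commutes with `splice`.
cyclicSplice-sequential : ∀ t i b y j z → i ℕ.< length t → j ℕ.< length y →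
  cyclicSplice (cyclicSplice t i (b ∷ y)) (i + j) z ≡ cyclicSplice t i (cyclicSplice (b ∷ y) j z)
cyclicSplice-sequential t i b y j z i< j< = begin
  cyclicSplice (cyclicSplice t i (b ∷ y)) (i + j) z
    ≡⟨ cyclicSplice-inner _ (i + j) z inner ⟩
  splice (cyclicSplice t i (b ∷ y)) (i + j) z
    ≡⟨ step ⟩
  cyclicSplice t i (splice (b ∷ y) j z)
    ≡⟨ cong (cyclicSplice t i) (cyclicSplice-inner (b ∷ y) j z (s≤s j<)) ⟨
  cyclicSplice t i (cyclicSplice (b ∷ y) j z) ∎
  where
  inner : suc (i + j) ℕ.< length (cyclicSplice t i (b ∷ y))
  inner = subst (suc (i + j) ℕ.<_) (sym (length-cyclicSplice t i b y i<)) (ℕ.+-mono-≤-< i< j<)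
  step : splice (cyclicSplice t i (b ∷ y)) (i + j) z ≡ cyclicSplice t i (splice (b ∷ y) j z)
  step with suc i ℕ.≟ length t
  ... | yes _ = trans (splice-incHead (splice t i (b ∷ y)) (i + j) z)
                      (cong incHead (splice-sequential t i (b ∷ y) j z (s≤s j<)))
  ... | no _  = splice-sequential t i (b ∷ y) j z (s≤s j<)

-- Only `j` can be last, because `i` precedes it, and it is last in `t` exactly when its shifted
-- copy is last after the graft at `i`. Both sides then carry the same `incHead`.
cyclicSplice-parallel : ∀ t i j b y c z → i ℕ.< j → j ℕ.< length t →
  cyclicSplice (cyclicSplice t i (b ∷ y)) (j + length y) (c ∷ z) ≡
  cyclicSplice (cyclicSplice t j (c ∷ z)) i (b ∷ y)
cyclicSplice-parallel t i j b y c z i<j j< = begin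
  cyclicSplice (cyclicSplice t i (b ∷ y)) (j + length y) (c ∷ z)
    ≡⟨ cong (λ u → cyclicSplice u (j + length y) (c ∷ z)) (cyclicSplice-inner t i _ (ℕ.≤-<-trans i<j j<)) ⟩
  cyclicSplice (splice t i (b ∷ y)) (j + length y) (c ∷ z)
    ≡⟨ step ⟩
  splice (cyclicSplice t j (c ∷ z)) i (b ∷ y)
    ≡⟨ cyclicSplice-inner _ i (b ∷ y) inner ⟨
  cyclicSplice (cyclicSplice t j (c ∷ z)) i (b ∷ y) ∎
  where
  inner : suc i ℕ.< length (cyclicSplice t j (c ∷ z))
  inner = subst (suc i ℕ.<_) (sym (length-cyclicSplice t j c z j<))
            (ℕ.<-≤-trans (ℕ.≤-<-trans i<j j<) (ℕ.m≤m+n (length t) (length z)))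
  len : length (splice t i (b ∷ y)) ≡ length t + length y
  len = length-splice t i b y (ℕ.<-trans i<j j<)
  par : splice (splice t i (b ∷ y)) (j + length y) (c ∷ z) ≡ splice (splice t j (c ∷ z)) i (b ∷ y)
  par = splice-parallel t i j b y (c ∷ z) i<j
  step : cyclicSplice (splice t i (b ∷ y)) (j + length y) (c ∷ z) ≡
         splice (cyclicSplice t j (c ∷ z)) i (b ∷ y)
  step with ℕ.m≤n⇒m<n∨m≡n j<
  ... | inj₁ j<′ = begin
    cyclicSplice (splice t i (b ∷ y)) (j + length y) (c ∷ z)
      ≡⟨ cyclicSplice-inner _ _ _ (subst (suc (j + length y) ℕ.<_) (sym len) (ℕ.+-monoˡ-< (length y) j<′)) ⟩
    splice (splice t i (b ∷ y)) (j + length y) (c ∷ z)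
      ≡⟨ par ⟩
    splice (splice t j (c ∷ z)) i (b ∷ y)
      ≡⟨ cong (λ u → splice u i (b ∷ y)) (cyclicSplice-inner t j _ j<′) ⟨
    splice (cyclicSplice t j (c ∷ z)) i (b ∷ y) ∎
  ... | inj₂ j≡ = begin
    cyclicSplice (splice t i (b ∷ y)) (j + length y) (c ∷ z)
      ≡⟨ cyclicSplice-last _ _ _ (trans (cong (_+ length y) j≡) (sym len)) ⟩
    incHead (splice (splice t i (b ∷ y)) (j + length y) (c ∷ z))
      ≡⟨ cong incHead par ⟩
    incHead (splice (splice t j (c ∷ z)) i (b ∷ y))
      ≡⟨ splice-incHead (splice t j (c ∷ z)) i (b ∷ y) ⟨
    splice (incHead (splice t j (c ∷ z))) i (b ∷ y)
      ≡⟨ cong (λ u → splice u i (b ∷ y)) (cyclicSplice-last t j _ j≡) ⟨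
    splice (cyclicSplice t j (c ∷ z)) i (b ∷ y) ∎

-- Sequences generated by inner ears, and their closure under grafting

digon : List ℕ
digon = 0 ∷ 0 ∷ []

data Generated : List ℕ → Set where
  base : Generated digon
  ear  : ∀ {t} i → suc i ℕ.< length t → Generated t → Generated (splice t i digon)

-- Parallel composition moves the ear at the last gap in front of every inner ear, down to the
-- digon. There both gaps yield (1,1,1), so the ear may be taken at the inner one.
generated-last-ear : ∀ {t} i → suc i ≡ length t → Generated t → Generated (cyclicSplice t i digon)
generated-last-ear i i≡ base with refl ← i≡ = ear 0 (s≤s (s≤s z≤n)) base
generated-last-ear i i≡ (ear {t} j j< g) =
  subst Generated (sym eq)
    (ear j (subst (suc j ℕ.<_) (sym (length-cyclicSplice t _ 0 _ l<)) (ℕ.≤-trans j< (ℕ.m≤m+n _ _)))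
      (generated-last-ear (ℕ.pred (length t)) sp g))
  where
  sp : suc (ℕ.pred (length t)) ≡ length t
  sp = ℕ.suc-pred (length t) {{ℕ.>-nonZero (ℕ.<-trans (s≤s z≤n) j<)}}
  l< : ℕ.pred (length t) ℕ.< length t
  l< = ℕ.≤-reflexive sp
  j<l : j ℕ.< ℕ.pred (length t)
  j<l = ℕ.s≤s⁻¹ (subst (suc j ℕ.<_) (sym sp) j<)
  -- The digon without its head has length 1, so the ear at `j` moves the last position of `t` up by
  -- one.
  i≡′ : i ≡ ℕ.pred (length t) + 1
  i≡′ = ℕ.suc-injective (trans i≡ (trans (length-splice t j 0 _ (ℕ.<-trans (ℕ.n<1+n j) j<)) (cong (_+ 1) (sym sp))))
  eq : cyclicSplice (splice t j digon) i digon ≡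
       splice (cyclicSplice t (ℕ.pred (length t)) digon) j digon
  eq = begin
    cyclicSplice (splice t j digon) i digon
      ≡⟨ cong₂ (λ u k → cyclicSplice u k digon) (sym (cyclicSplice-inner t j digon j<)) i≡′ ⟩
    cyclicSplice (cyclicSplice t j digon) (ℕ.pred (length t) + 1) digon
      ≡⟨ cyclicSplice-parallel t j _ 0 _ 0 _ j<l l< ⟩
    cyclicSplice (cyclicSplice t (ℕ.pred (length t)) digon) j digon
      ≡⟨ cyclicSplice-inner _ j digon (subst (suc j ℕ.<_) (sym (length-cyclicSplice t _ 0 _ l<)) (ℕ.≤-trans j< (ℕ.m≤m+n _ _))) ⟩
    splice (cyclicSplice t (ℕ.pred (length t)) digon) j digon ∎

-- Induction on the ears of `s`: by sequential composition, an ear at gap `j` of `s` can be inserted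
-- after the graft, at gap `i + j`. That gap is again inner, because `j` is.
generated-cyclicSplice : ∀ {t s} i → i ℕ.< length t → Generated t → Generated s →
  Generated (cyclicSplice t i s)
generated-cyclicSplice {t} i i< g base with ℕ.m≤n⇒m<n∨m≡n i<
... | inj₁ i<′ = subst Generated (sym (cyclicSplice-inner t i digon i<′)) (ear i i<′ g)
... | inj₂ i≡  = generated-last-ear i i≡ g
generated-cyclicSplice {t} i i< g (ear {b ∷ y} j (s≤s j<) h) =
  subst Generated eq (ear (i + j) inner (generated-cyclicSplice i i< g h))
  where
  inner : suc (i + j) ℕ.< length (cyclicSplice t i (b ∷ y))
  inner = subst (suc (i + j) ℕ.<_) (sym (length-cyclicSplice t i b y i<)) (ℕ.+-mono-≤-< i< j<)
  eq : splice (cyclicSplice t i (b ∷ y)) (i + j) digon ≡ cyclicSplice t i (splice (b ∷ y) j digon)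
  eq = begin
    splice (cyclicSplice t i (b ∷ y)) (i + j) digon
      ≡⟨ cyclicSplice-inner _ (i + j) digon inner ⟨
    cyclicSplice (cyclicSplice t i (b ∷ y)) (i + j) digon
      ≡⟨ cyclicSplice-sequential t i b y j digon i< j< ⟩
    cyclicSplice t i (cyclicSplice (b ∷ y) j digon)
      ≡⟨ cong (cyclicSplice t i) (cyclicSplice-inner (b ∷ y) j digon (s≤s j<)) ⟩
    cyclicSplice t i (splice (b ∷ y) j digon) ∎

-- Triangulations as edge sets

-- A triangulation, seen as a maximal noncrossing set of chords; it contains the
-- sides of the polygon since these cross nothing.
record EdgeSet (n : ℕ) : Set₁ where
  field
    Edge        : Fin n → Fin n → Set
    edge?       : ∀ a b → Dec (Edge a b)
    ordered     : ∀ {a b} → Edge a b → a < b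
    noncrossing : ∀ {a b c d} → Edge a b → Edge c d → ¬ Crosses (a , b) (c , d)
    maximal     : ∀ {a b} → a < b → (∀ {c d} → Edge c d → ¬ Crosses (a , b) (c , d)) → Edge a b

Crosses-sym : ∀ {n} {e f : Chord n} → Crosses e f → Crosses f e
Crosses-sym = Sum.swap

-- A crossing needs an endpoint of `f` strictly between those of `e` and another strictly outside.
-- Consecutive labels leave none between, and the first and last labels leave none outside.
side-uncrossed : ∀ {n} {e f : Chord n} → IsSide e → ¬ Crosses e f
side-uncrossed (inj₁ p) (inj₁ (a<c , c<b , _)) = ℕ.<⇒≱ c<b (subst (ℕ._≤ _) p a<c)
side-uncrossed (inj₁ p) (inj₂ (_ , a<d , d<b)) = ℕ.<⇒≱ d<b (subst (ℕ._≤ _) p a<d)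
side-uncrossed {f = _ , d} (inj₂ (_ , q)) (inj₁ (_ , _ , b<d)) =
  ℕ.<⇒≱ (toℕ<n d) (subst (ℕ._≤ toℕ d) q b<d)
side-uncrossed (inj₂ (p , _)) (inj₂ (c<a , _)) = ℕ.n≮0 (subst (_ ℕ.<_) p c<a)

side-edge : ∀ {n} (E : EdgeSet n) {a b} → a < b → IsSide (a , b) → EdgeSet.Edge E a b
side-edge E a<b s = EdgeSet.maximal E a<b (λ _ → side-uncrossed s)

edgeSet : ∀ {n} → Triangulation n → EdgeSet n
edgeSet Θ = record
  { Edge        = λ a b → a < b × IsEdge Θ (a , b)
  ; edge?       = λ a b → (a <? b) ×-dec isEdge? Θ (a , b)
  ; ordered     = proj₁
  ; noncrossing = nc
  ; maximal     = mx
  }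
  where
  open Triangulation Θ
  nc : ∀ {a b c d} → a < b × IsEdge Θ (a , b) → c < d × IsEdge Θ (c , d) → ¬ Crosses (a , b) (c , d)
  nc (_ , inj₁ s)  _              = side-uncrossed s
  nc (_ , inj₂ _)  (_ , inj₁ s)   = side-uncrossed s ∘ Crosses-sym
  nc (_ , inj₂ e∈) (_ , inj₂ f∈)  = noncrossing e∈ f∈
  mx : ∀ {a b} → a < b → (∀ {c d} → c < d × IsEdge Θ (c , d) → ¬ Crosses (a , b) (c , d)) →
       a < b × IsEdge Θ (a , b)
  mx {a} {b} a<b h with isSide? (a , b)
  ... | yes s = a<b , inj₁ s
  ... | no ¬s = a<b , inj₂ (maximal (a<b , ¬s) (λ f∈ → h (proj₁ (isDiagonal f∈) , inj₂ f∈)))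

_≐_ : ∀ {n} → EdgeSet n → EdgeSet n → Set
E ≐ F = ∀ {a b} → EdgeSet.Edge E a b ⇔ EdgeSet.Edge F a b

-- Decidability turns the edges that are not sides into a list. The sides return through `IsEdge`,
-- with different proofs of being an edge, hence the comparison by `≐`.
triangulation : ∀ {n} (E : EdgeSet n) → Σ[ Θ ∈ Triangulation n ] edgeSet Θ ≐ E
triangulation {n} E = Θ , mk⇔ to from
  where
  open EdgeSet E
  P? : (e : Chord n) → Dec (¬ IsSide e × Edge (proj₁ e) (proj₂ e))
  P? (a , b) = ¬? (isSide? (a , b)) ×-dec edge? a b
  chords : List (Chord n)
  chords = cartesianProduct (allFin n) (allFin n)
  ds : List (Chord n)
  ds = filter P? chords
  ds⁺ : ∀ {a b} → ¬ IsSide (a , b) → Edge a b → (a , b) ∈ ds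
  ds⁺ ¬s e = ∈-filter⁺ P? (∈-cartesianProduct⁺ (∈-allFin _) (∈-allFin _)) (¬s , e)
  ds⁻ : ∀ {e} → e ∈ ds → ¬ IsSide e × Edge (proj₁ e) (proj₂ e)
  ds⁻ e∈ = proj₂ (∈-filter⁻ P? {xs = chords} e∈)
  mx : ∀ {e} → IsDiagonal e → (∀ {f} → f ∈ ds → ¬ Crosses e f) → e ∈ ds
  mx {e} (a<b , ¬s) h = ds⁺ ¬s (maximal a<b uncrossed)
    where
    uncrossed : ∀ {c d} → Edge c d → ¬ Crosses e (c , d)
    uncrossed {c} {d} f with isSide? (c , d)
    ... | yes s  = side-uncrossed s ∘ Crosses-sym
    ... | no ¬s′ = h (ds⁺ ¬s′ f)
  Θ : Triangulation n
  Θ = record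
    { diagonals   = ds
    ; isDiagonal  = λ e∈ → let (¬s , e) = ds⁻ e∈ in ordered e , ¬s
    ; noncrossing = λ e∈ f∈ → noncrossing (proj₂ (ds⁻ e∈)) (proj₂ (ds⁻ f∈))
    ; maximal     = mx
    }
  to : ∀ {a b} → a < b × IsEdge Θ (a , b) → Edge a b
  to (a<b , inj₁ s)  = side-edge E a<b s
  to (_   , inj₂ e∈) = proj₂ (ds⁻ e∈)
  from : ∀ {a b} → Edge a b → a < b × IsEdge Θ (a , b)
  from {a} {b} e with isSide? (a , b)
  ... | yes s = ordered e , inj₁ s
  ... | no ¬s = ordered e , inj₂ (ds⁺ ¬s e)

-- Deleting and inserting the tip of an ear

punchIn-mono-< : ∀ {n} k {a b : Fin n} → a < b → punchIn k a < punchIn k b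
punchIn-mono-< k {a} {b} a<b = ℕ.≰⇒> (ℕ.<⇒≱ a<b ∘ punchIn-cancel-≤ k b a)

punchIn-cancel-< : ∀ {n} k {a b : Fin n} → punchIn k a < punchIn k b → a < b
punchIn-cancel-< k {a} {b} a<b = ℕ.≰⇒> (ℕ.<⇒≱ a<b ∘ punchIn-mono-≤ k b a)

Crosses-punchIn⁺ : ∀ {n} k {a b c d : Fin n} → Crosses (a , b) (c , d) →
  Crosses (punchIn k a , punchIn k b) (punchIn k c , punchIn k d)
Crosses-punchIn⁺ k (inj₁ (p , q , r)) = inj₁ (punchIn-mono-< k p , punchIn-mono-< k q , punchIn-mono-< k r)
Crosses-punchIn⁺ k (inj₂ (p , q , r)) = inj₂ (punchIn-mono-< k p , punchIn-mono-< k q , punchIn-mono-< k r)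

Crosses-punchIn⁻ : ∀ {n} k {a b c d : Fin n} →
  Crosses (punchIn k a , punchIn k b) (punchIn k c , punchIn k d) → Crosses (a , b) (c , d)
Crosses-punchIn⁻ k (inj₁ (p , q , r)) = inj₁ (punchIn-cancel-< k p , punchIn-cancel-< k q , punchIn-cancel-< k r)
Crosses-punchIn⁻ k (inj₂ (p , q , r)) = inj₂ (punchIn-cancel-< k p , punchIn-cancel-< k q , punchIn-cancel-< k r)

data PunchView {n} (k : Fin (suc n)) : Fin (suc n) → Set where
  hole : PunchView k k
  kept : ∀ a → PunchView k (punchIn k a)

punchView : ∀ {n} (k a : Fin (suc n)) → PunchView k a
punchView k a with k ≟ a
... | yes refl = hole
... | no k≢a   = subst (PunchView k) (punchIn-punchOut k≢a) (kept (punchOut k≢a))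

-- The ear cut off at gap i has tip k and base p — q.
module Gap {m : ℕ} (i : Fin (suc m)) where

  k p q : Fin (3 + m)
  k = suc (inject₁ i)
  p = inject₁ (inject₁ i)
  q = suc (suc i)

  punchIn-left : ∀ {m} (i : Fin (suc m)) → punchIn (suc (inject₁ i)) (inject₁ i) ≡ inject₁ (inject₁ i)
  punchIn-left             zero    = refl
  punchIn-left {m = suc _} (suc i) = cong suc (punchIn-left i)

  punchIn-right : ∀ {m} (i : Fin (suc m)) → punchIn (suc (inject₁ i)) (suc i) ≡ suc (suc i)
  punchIn-right             zero    = refl
  punchIn-right {m = suc _} (suc i) = cong suc (punchIn-right i)

  suc-p : suc (toℕ p) ≡ toℕ k
  suc-p = cong suc (toℕ-inject₁ (inject₁ i))

  suc-k : suc (toℕ k) ≡ toℕ q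
  suc-k = cong (2 +_) (toℕ-inject₁ i)

  p<k : p < k
  p<k = ℕ.≤-reflexive suc-p

  k<q : k < q
  k<q = ℕ.≤-reflexive suc-k

  <k⇒≤p : ∀ {x : Fin (3 + m)} → x < k → x ≤ p
  <k⇒≤p {x} x<k = ℕ.s≤s⁻¹ (subst (suc (toℕ x) ℕ.≤_) (sym suc-p) x<k)

  >k⇒≥q : ∀ {x : Fin (3 + m)} → k < x → q ≤ x
  >k⇒≥q {x} k<x = subst (ℕ._≤ toℕ x) suc-k k<x

  <k⇒≡p∨<p : ∀ {x : Fin (3 + m)} → x < k → x ≡ p ⊎ x < p
  <k⇒≡p∨<p x<k with ℕ.m≤n⇒m<n∨m≡n (<k⇒≤p x<k)
  ... | inj₁ x<p = inj₂ x<p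
  ... | inj₂ x≡p = inj₁ (toℕ-injective x≡p)

  >k⇒≡q∨>q : ∀ {x : Fin (3 + m)} → k < x → x ≡ q ⊎ q < x
  >k⇒≡q∨>q k<x with ℕ.m≤n⇒m<n∨m≡n (>k⇒≥q k<x)
  ... | inj₁ q<x = inj₂ q<x
  ... | inj₂ q≡x = inj₁ (sym (toℕ-injective q≡x))

  -- The triangle itself is derived: its legs are sides of the larger polygon, and its base is the
  -- image of a side of the smaller one.
  record IsEar (E′ : EdgeSet (3 + m)) (E : EdgeSet (2 + m)) : Set where
    private
      module E = EdgeSet E
      module E′ = EdgeSet E′
    field
      outer : ∀ {a b} → E.Edge a b ⇔ E′.Edge (punchIn k a) (punchIn k b)
      from-tip : ∀ {b} → E′.Edge k b → b ≡ q
      to-tip   : ∀ {a} → E′.Edge a k → a ≡ p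

  open IsEar public

  innerBase : ∀ (E : EdgeSet (2 + m)) → EdgeSet.Edge E (inject₁ i) (suc i)
  innerBase E = side-edge E (ℕ.≤-reflexive suc-i) (inj₁ suc-i)
    where
    suc-i : suc (toℕ (inject₁ i)) ≡ suc (toℕ i)
    suc-i = cong suc (toℕ-inject₁ i)

  earBase : ∀ {E′ E} → IsEar E′ E → EdgeSet.Edge E′ p q
  earBase {E′} {E} ie = subst₂ (EdgeSet.Edge E′) (punchIn-left i) (punchIn-right i)
    (Equivalence.to (outer ie) (innerBase E))

  leftLeg : ∀ (E′ : EdgeSet (3 + m)) → EdgeSet.Edge E′ p k
  leftLeg E′ = side-edge E′ p<k (inj₁ suc-p)

  rightLeg : ∀ (E′ : EdgeSet (3 + m)) → EdgeSet.Edge E′ k q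
  rightLeg E′ = side-edge E′ k<q (inj₁ suc-k)

  -- Any edge at the tip other than a leg would cross the base. The edges lost are therefore sides,
  -- which obstruct no chord, so maximality survives the cut.
  cutEar : (E′ : EdgeSet (3 + m)) → EdgeSet.Edge E′ p q → Σ[ E ∈ EdgeSet (2 + m) ] IsEar E′ E
  cutEar E′ pq = E , record { outer = mk⇔ id id ; from-tip = ft ; to-tip = tt }
    where
    open EdgeSet E′
    ft : ∀ {b} → Edge k b → b ≡ q
    ft e with >k⇒≡q∨>q (ordered e)
    ... | inj₁ b≡q = b≡q
    ... | inj₂ q<b = contradiction (inj₁ (p<k , k<q , q<b)) (noncrossing pq e)
    tt : ∀ {a} → Edge a k → a ≡ p
    tt e with <k⇒≡p∨<p (ordered e)
    ... | inj₁ a≡p = a≡p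
    ... | inj₂ a<p = contradiction (inj₂ (a<p , p<k , k<q)) (noncrossing pq e)
    E : EdgeSet (2 + m)
    E = record
      { Edge        = λ a b → Edge (punchIn k a) (punchIn k b)
      ; edge?       = λ a b → edge? (punchIn k a) (punchIn k b)
      ; ordered     = punchIn-cancel-< k ∘ ordered
      ; noncrossing = λ e f → noncrossing e f ∘ Crosses-punchIn⁺ k
      ; maximal     = λ {a} {b} a<b h → maximal (punchIn-mono-< k a<b) (uncrossed {a} {b} h)
      }
      where
      uncrossed : ∀ {a b} →
        (∀ {c d} → Edge (punchIn k c) (punchIn k d) → ¬ Crosses (a , b) (c , d)) →
        ∀ {c d} → Edge c d → ¬ Crosses (punchIn k a , punchIn k b) (c , d)
      uncrossed h {c} {d} e with punchView k c | punchView k d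
      ... | kept _ | kept _ = h e ∘ Crosses-punchIn⁻ k
      ... | hole   | _      with refl ← ft e = side-uncrossed (inj₁ suc-k) ∘ Crosses-sym
      ... | kept _ | hole   with eq ← tt e = side-uncrossed (inj₁ (trans (cong (suc ∘ toℕ) eq) suc-p)) ∘ Crosses-sym

  -- The new edges are sides and cross nothing. For maximality, a chord at the tip that is not a leg
  -- crosses the base, which is already an edge; any other chord comes from the smaller polygon.
  glueEar : (E : EdgeSet (2 + m)) → Σ[ E′ ∈ EdgeSet (3 + m) ] IsEar E′ E
  glueEar E = E′ , record { outer = mk⇔ outer⁺ outer⁻ ; from-tip = ft ; to-tip = tt }
    where
    open EdgeSet E
    Edge′ : Fin (3 + m) → Fin (3 + m) → Set
    Edge′ a b = (a ≡ p × b ≡ k) ⊎ (a ≡ k × b ≡ q) ⊎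
                (∃[ c ] ∃[ d ] Edge c d × a ≡ punchIn k c × b ≡ punchIn k d)
    edge′? : ∀ a b → Dec (Edge′ a b)
    edge′? a b = ((a ≟ p) ×-dec (b ≟ k)) ⊎-dec ((a ≟ k) ×-dec (b ≟ q)) ⊎-dec
      any? (λ c → any? (λ d → edge? c d ×-dec (a ≟ punchIn k c) ×-dec (b ≟ punchIn k d)))
    outer⁺ : ∀ {a b} → Edge a b → Edge′ (punchIn k a) (punchIn k b)
    outer⁺ e = inj₂ (inj₂ (_ , _ , e , refl , refl))
    outer⁻ : ∀ {a b} → Edge′ (punchIn k a) (punchIn k b) → Edge a b
    outer⁻ (inj₁ (_ , eq))        = contradiction eq (punchInᵢ≢i k _)
    outer⁻ (inj₂ (inj₁ (eq , _))) = contradiction eq (punchInᵢ≢i k _)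
    outer⁻ (inj₂ (inj₂ (_ , _ , e , eq₁ , eq₂)))
      with refl ← punchIn-injective k _ _ eq₁ | refl ← punchIn-injective k _ _ eq₂ = e
    ft : ∀ {b} → Edge′ k b → b ≡ q
    ft (inj₁ (eq , _)) = contradiction p<k (ℕ.<-irrefl (cong toℕ (sym eq)))
    ft (inj₂ (inj₁ (_ , eq))) = eq
    ft (inj₂ (inj₂ (_ , _ , _ , eq , _))) = contradiction (sym eq) (punchInᵢ≢i k _)
    tt : ∀ {a} → Edge′ a k → a ≡ p
    tt (inj₁ (eq , _)) = eq
    tt (inj₂ (inj₁ (_ , eq))) = contradiction k<q (ℕ.<-irrefl (cong toℕ eq))
    tt (inj₂ (inj₂ (_ , _ , _ , _ , eq))) = contradiction (sym eq) (punchInᵢ≢i k _)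
    ord : ∀ {a b} → Edge′ a b → a < b
    ord (inj₁ (refl , refl)) = p<k
    ord (inj₂ (inj₁ (refl , refl))) = k<q
    ord (inj₂ (inj₂ (_ , _ , e , refl , refl))) = punchIn-mono-< k (ordered e)
    nc : ∀ {a b c d} → Edge′ a b → Edge′ c d → ¬ Crosses (a , b) (c , d)
    nc (inj₁ (refl , refl))        _ = side-uncrossed (inj₁ suc-p)
    nc (inj₂ (inj₁ (refl , refl))) _ = side-uncrossed (inj₁ suc-k)
    nc (inj₂ (inj₂ _)) (inj₁ (refl , refl))        = side-uncrossed (inj₁ suc-p) ∘ Crosses-sym
    nc (inj₂ (inj₂ _)) (inj₂ (inj₁ (refl , refl))) = side-uncrossed (inj₁ suc-k) ∘ Crosses-sym
    nc (inj₂ (inj₂ (_ , _ , e , refl , refl))) (inj₂ (inj₂ (_ , _ , f , refl , refl))) =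
      noncrossing e f ∘ Crosses-punchIn⁻ k
    pq : Edge′ p q
    pq = subst₂ Edge′ (punchIn-left i) (punchIn-right i) (outer⁺ (innerBase E))
    mx : ∀ {a b} → a < b → (∀ {c d} → Edge′ c d → ¬ Crosses (a , b) (c , d)) → Edge′ a b
    mx {a} {b} a<b h with punchView k a | punchView k b
    ... | kept _ | kept _ = outer⁺ (maximal (punchIn-cancel-< k a<b)
                              (λ e → h (outer⁺ e) ∘ Crosses-punchIn⁺ k))
    ... | hole   | _ with >k⇒≡q∨>q a<b
    ...   | inj₁ b≡q = inj₂ (inj₁ (refl , b≡q))
    ...   | inj₂ q<b = contradiction (inj₂ (p<k , k<q , q<b)) (h pq)
    mx {a} {b} a<b h | kept _ | hole with <k⇒≡p∨<p a<b
    ...   | inj₁ a≡p = inj₁ (a≡p , refl)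
    ...   | inj₂ a<p = contradiction (inj₁ (a<p , p<k , k<q)) (h pq)
    E′ : EdgeSet (3 + m)
    E′ = record { Edge = Edge′ ; edge? = edge′? ; ordered = ord ; noncrossing = nc ; maximal = mx }

-- Descends on the length of a — b: the chord cutting off the vertex after the left
-- end of an edge is either an edge or crossed by a shorter edge below the first.
earBelow : ∀ {m} (E : EdgeSet (3 + m)) d (a b : Fin (3 + m)) → EdgeSet.Edge E a b →
  2 + toℕ a ℕ.≤ toℕ b → toℕ b ℕ.≤ d + toℕ a →
  ∃[ i ] EdgeSet.Edge E (Gap.p {m} i) (Gap.q i)
earBelow E zero a b _ a+2≤b b≤a = contradiction (ℕ.≤-trans a+2≤b b≤a) (ℕ.<⇒≱ (ℕ.m<n⇒m<1+n (ℕ.n<1+n _)))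
earBelow {m} E (suc d) a b ab a+2≤b b≤ = found
  where
  open EdgeSet E
  a<1+m : toℕ a ℕ.< suc m
  a<1+m = ℕ.s≤s⁻¹ (ℕ.≤-trans a+2≤b (toℕ≤pred[n] b))
  -- This choice makes the base of the ear run from `a` to `a` plus 2.
  i : Fin (suc m)
  i = fromℕ< a<1+m
  open Gap i using (p; q; p<k; k<q)
  p≡a : p ≡ a
  p≡a = toℕ-injective (trans (toℕ-inject₁ _) (trans (toℕ-inject₁ _) (toℕ-fromℕ< a<1+m)))
  pb : Edge p b
  pb = subst (λ x → Edge x b) (sym p≡a) ab
  q≤b : q ≤ b
  q≤b = subst (λ x → 2 + x ℕ.≤ toℕ b) (sym (toℕ-fromℕ< a<1+m)) a+2≤b
  crossing? : Dec (∃[ c ] ∃[ e ] Edge c e × Crosses (p , q) (c , e))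
  crossing? = any? λ c → any? λ e → edge? c e ×-dec
    (((p <? c) ×-dec (c <? q) ×-dec (q <? e)) ⊎-dec ((c <? p) ×-dec (p <? e) ×-dec (e <? q)))
  found : ∃[ i ] Edge (Gap.p i) (Gap.q i)
  found with crossing?
  ... | no ¬c = i , maximal (Fin.<-trans p<k k<q) (λ {c} {e} f x → ¬c (c , e , f , x))
  -- The crossing edge starts after `a` and cannot end beyond `b` without crossing `a`  -  `b`, so
  -- the length bound drops by one. It starts before `q` and ends after it, so its length is still
  -- at least 2.
  ... | yes (c , e , ce , inj₁ (p<c , c<q , q<e)) =
    earBelow E d c e ce
      (ℕ.≤-trans (s≤s c<q) q<e)
      (ℕ.≤-trans e≤b (ℕ.≤-trans b≤ (ℕ.≤-trans (ℕ.≤-reflexive (sym (ℕ.+-suc d (toℕ a))))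
        (ℕ.+-monoʳ-≤ d (subst (λ x → toℕ x ℕ.< toℕ c) p≡a p<c)))))
    where
    e≤b : e ≤ b
    e≤b = ℕ.≮⇒≥ λ b<e → noncrossing pb ce (inj₁ (p<c , ℕ.<-≤-trans c<q q≤b , b<e))
  -- An edge entering from before `p` ends strictly between `a` and `b`, hence crosses `a`  -  `b`.
  ... | yes (c , e , ce , inj₂ (c<p , p<e , e<q)) =
    contradiction (inj₂ (c<p , p<e , ℕ.<-≤-trans e<q q≤b)) (noncrossing pb ce)

-- The descent starts at the side joining the first and the last vertex, an edge below which all
-- other vertices lie.
hasEar : ∀ {m} (E : EdgeSet (3 + m)) → ∃[ i ] EdgeSet.Edge E (Gap.p {m} i) (Gap.q i)
hasEar {m} E = earBelow E (2 + m) zero (fromℕ (2 + m))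
  (side-edge E (s≤s z≤n) (inj₂ (refl , cong suc (toℕ-fromℕ _))))
  (ℕ.≤-trans (s≤s (s≤s z≤n)) (ℕ.≤-reflexive (sym (toℕ-fromℕ (2 + m)))))
  (ℕ.≤-trans (ℕ.≤-reflexive (toℕ-fromℕ (2 + m))) (ℕ.m≤m+n _ 0))

-- Counting triangles

shift : ∀ {n} → Fin (suc n) → Triple n → Triple (suc n)
shift k (a , b , c) = punchIn k a , punchIn k b , punchIn k c

shift-injective : ∀ {n} k {Δ Δ′ : Triple n} → shift k Δ ≡ shift k Δ′ → Δ ≡ Δ′
shift-injective k {a , b , c} {a′ , b′ , c′} eq
  with refl ← punchIn-injective k a a′ (cong proj₁ eq)
     | refl ← punchIn-injective k b b′ (cong (proj₁ ∘ proj₂) eq)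
     | refl ← punchIn-injective k c c′ (cong (proj₂ ∘ proj₂) eq) = refl

module _ {n : ℕ} (Θ : Triangulation n) where
  open EdgeSet (edgeSet Θ)

  triangles : List (Triple n)
  triangles = filter (isTriangle? Θ) (triples n)

  triangles-unique : Unique triangles
  triangles-unique = Unique.filter⁺ (isTriangle? Θ)
    (Unique.cartesianProduct⁺ (Unique.allFin⁺ n) (Unique.cartesianProduct⁺ (Unique.allFin⁺ n) (Unique.allFin⁺ n)))

  ∈-triangles⁺ : ∀ {a b c} → Edge a b → Edge b c → Edge a c → (a , b , c) ∈ triangles
  ∈-triangles⁺ (a<b , ab) (b<c , bc) (_ , ac) = ∈-filter⁺ (isTriangle? Θ)
    (∈-cartesianProduct⁺ (∈-allFin _) (∈-cartesianProduct⁺ (∈-allFin _) (∈-allFin _)))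
    (a<b , b<c , ab , bc , ac)

  ∈-triangles⁻ : ∀ {a b c} → (a , b , c) ∈ triangles → Edge a b × Edge b c × Edge a c
  ∈-triangles⁻ Δ∈ with _ , a<b , b<c , ab , bc , ac ← ∈-filter⁻ (isTriangle? Θ) {xs = triples n} Δ∈
    = (a<b , ab) , (b<c , bc) , (ℕ.<-trans a<b b<c , ac)

filter-×-dec : ∀ {A : Set} {P Q : A → Set} (P? : ∀ x → Dec (P x)) (Q? : ∀ x → Dec (Q x)) xs →
  filter (λ x → P? x ×-dec Q? x) xs ≡ filter Q? (filter P? xs)
filter-×-dec P? Q? [] = refl
filter-×-dec P? Q? (x ∷ xs) with P? x
... | no  _ = filter-×-dec P? Q? xs
... | yes _ with Q? x
...   | no  _ = filter-×-dec P? Q? xs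
...   | yes _ = cong (x ∷_) (filter-×-dec P? Q? xs)

lookup-quiddity : ∀ {n} (Θ : Triangulation n) v →
  lookup (quiddity Θ) v ≡ length (filter (incident? v) (triangles Θ))
lookup-quiddity {n} Θ v = trans
  (lookup∘tabulate (λ v → length (filter (λ Δ → isTriangle? Θ Δ ×-dec incident? v Δ) (triples n))) v)
  (cong length (filter-×-dec (isTriangle? Θ) (incident? v) (triples n)))

length-filter-map : ∀ {A B : Set} {P : A → Set} {Q : B → Set}
  (P? : ∀ x → Dec (P x)) (Q? : ∀ y → Dec (Q y)) (f : A → B) →
  (∀ {x} → P x → Q (f x)) → (∀ {x} → Q (f x) → P x) →
  ∀ xs → length (filter Q? (map f xs)) ≡ length (filter P? xs)
length-filter-map P? Q? f to from [] = refl
length-filter-map P? Q? f to from (x ∷ xs) with P? x | Q? (f x)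
... | yes _ | yes _ = cong suc (length-filter-map P? Q? f to from xs)
... | no  _ | no  _ = length-filter-map P? Q? f to from xs
... | yes a | no ¬b = contradiction (to a) ¬b
... | no ¬a | yes b = contradiction (from b) ¬a

incident-shift⁺ : ∀ {n} (k : Fin (suc n)) {v Δ} → Incident v Δ → Incident (punchIn k v) (shift k Δ)
incident-shift⁺ k = Sum.map (cong (punchIn k)) (Sum.map (cong (punchIn k)) (cong (punchIn k)))

incident-shift⁻ : ∀ {n} (k : Fin (suc n)) {v Δ} → Incident (punchIn k v) (shift k Δ) → Incident v Δ
incident-shift⁻ k = Sum.map (punchIn-injective k _ _) (Sum.map (punchIn-injective k _ _) (punchIn-injective k _ _))

hole-not-incident : ∀ {n} (k : Fin (suc n)) {Δ} → ¬ Incident k (shift k Δ)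
hole-not-incident k (inj₁ eq)        = punchInᵢ≢i k _ (sym eq)
hole-not-incident k (inj₂ (inj₁ eq)) = punchInᵢ≢i k _ (sym eq)
hole-not-incident k (inj₂ (inj₂ eq)) = punchInᵢ≢i k _ (sym eq)

-- Effect of an ear on the triangles and the quiddity sequence

insertEar : ∀ {m} → Fin (suc m) → Vec ℕ (2 + m) → Vec ℕ (3 + m)
insertEar         zero    (a ∷ b ∷ t) = suc a ∷ 1 ∷ suc b ∷ t
insertEar {suc m} (suc i) (a ∷ t)     = a ∷ insertEar i t

lookup-insertEar-tip : ∀ {m} (i : Fin (suc m)) t → lookup (insertEar i t) (suc (inject₁ i)) ≡ 1
lookup-insertEar-tip         zero    (a ∷ b ∷ t) = refl
lookup-insertEar-tip {suc m} (suc i) (a ∷ t)     = lookup-insertEar-tip i t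

lookup-insertEar-left : ∀ {m} (i : Fin (suc m)) t →
  lookup (insertEar i t) (inject₁ (inject₁ i)) ≡ suc (lookup t (inject₁ i))
lookup-insertEar-left         zero    (a ∷ b ∷ t) = refl
lookup-insertEar-left {suc m} (suc i) (a ∷ t)     = lookup-insertEar-left i t

lookup-insertEar-right : ∀ {m} (i : Fin (suc m)) t →
  lookup (insertEar i t) (suc (suc i)) ≡ suc (lookup t (suc i))
lookup-insertEar-right         zero    (a ∷ b ∷ t) = refl
lookup-insertEar-right {suc m} (suc i) (a ∷ t)     = lookup-insertEar-right i t

lookup-insertEar-outer : ∀ {m} (i : Fin (suc m)) t v → v ≢ inject₁ i → v ≢ suc i →
  lookup (insertEar i t) (punchIn (suc (inject₁ i)) v) ≡ lookup t v
lookup-insertEar-outer zero (a ∷ b ∷ t) zero          v≢ _  = contradiction refl v≢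
lookup-insertEar-outer zero (a ∷ b ∷ t) (suc zero)    _  v≢ = contradiction refl v≢
lookup-insertEar-outer zero (a ∷ b ∷ t) (suc (suc v)) _  _  = refl
lookup-insertEar-outer {suc m} (suc i) (a ∷ t) zero    _  _   = refl
lookup-insertEar-outer {suc m} (suc i) (a ∷ t) (suc v) v≢ v≢′ =
  lookup-insertEar-outer i t v (v≢ ∘ cong suc) (v≢′ ∘ cong suc)

module _ {m : ℕ} (i : Fin (suc m)) {Θ′ : Triangulation (3 + m)} {Θ : Triangulation (2 + m)} where
  open Gap i

  -- Neither list repeats a triangle, so equal membership makes them permutations of each other, and
  -- counts may be compared.
  triangles-ear : IsEar (edgeSet Θ′) (edgeSet Θ) →
    triangles Θ′ ↭ (p , k , q) ∷ map (shift k) (triangles Θ)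
  triangles-ear ie = ∼bag⇒↭ (unique∧set⇒bag (triangles-unique Θ′)
      (All.tabulate fresh ∷ Unique.map⁺ (shift-injective k) (triangles-unique Θ))
      (mk⇔ to from))
    where
    module E′ = EdgeSet (edgeSet Θ′)
    E′ = edgeSet Θ′
    fresh : ∀ {Δ} → Δ ∈ map (shift k) (triangles Θ) → (p , k , q) ≢ Δ
    fresh Δ∈ refl with _ , _ , eq ← ∈-map⁻ (shift k) Δ∈ =
      punchInᵢ≢i k _ (sym (cong (proj₁ ∘ proj₂) eq))
    to : ∀ {Δ} → Δ ∈ triangles Θ′ → Δ ∈ (p , k , q) ∷ map (shift k) (triangles Θ)
    to {a , b , c} Δ∈ with ∈-triangles⁻ Θ′ Δ∈ | punchView k a | punchView k b | punchView k c
    ... | ab , bc , ac | kept _ | kept _ | kept _ =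
      there (∈-map⁺ (shift k) (∈-triangles⁺ Θ (Equivalence.from (outer ie) ab)
        (Equivalence.from (outer ie) bc) (Equivalence.from (outer ie) ac)))
    ... | ab , bc , _  | _ | hole | _ with refl ← to-tip ie ab | refl ← from-tip ie bc = here refl
    -- As smallest vertex, the tip would have both its edges ending at `q`, so two vertices would
    -- coincide; as largest vertex, both would start at `p`.
    ... | ab , bc , ac | hole | _ | _ with refl ← from-tip ie ab | refl ← from-tip ie ac =
      contradiction (E′.ordered bc) (ℕ.<-irrefl refl)
    ... | ab , bc , ac | _ | _ | hole with refl ← to-tip ie bc | refl ← to-tip ie ac =
      contradiction (E′.ordered ab) (ℕ.<-irrefl refl)
    from : ∀ {Δ} → Δ ∈ (p , k , q) ∷ map (shift k) (triangles Θ) → Δ ∈ triangles Θ′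
    from (here refl) = ∈-triangles⁺ Θ′ (leftLeg E′) (rightLeg E′) (earBase ie)
    from (there Δ∈) with _ , Δ∈′ , refl ← ∈-map⁻ (shift k) Δ∈
      with ab , bc , ac ← ∈-triangles⁻ Θ Δ∈′ =
      ∈-triangles⁺ Θ′ (Equivalence.to (outer ie) ab) (Equivalence.to (outer ie) bc)
        (Equivalence.to (outer ie) ac)

  quiddity-ear : IsEar (edgeSet Θ′) (edgeSet Θ) → quiddity Θ′ ≡ insertEar i (quiddity Θ)
  quiddity-ear ie = lookup-ext pointwise
    where
    lookup-ext : ∀ {n} {s t : Vec ℕ n} → (∀ v → lookup s v ≡ lookup t v) → s ≡ t
    lookup-ext {s = []}    {[]}    _ = refl
    lookup-ext {s = _ ∷ _} {_ ∷ _} h = cong₂ _∷_ (h zero) (lookup-ext (h ∘ suc))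
    count : ∀ v → lookup (quiddity Θ′) v ≡
      length (filter (incident? v) ((p , k , q) ∷ map (shift k) (triangles Θ)))
    count v = trans (lookup-quiddity Θ′ v) (↭-length (filter-↭ (incident? v) (triangles-ear ie)))
    outerCount : ∀ v → length (filter (incident? (punchIn k v)) (map (shift k) (triangles Θ))) ≡
      lookup (quiddity Θ) v
    outerCount v = trans
      (length-filter-map (incident? v) (incident? (punchIn k v)) (shift k)
        (incident-shift⁺ k) (incident-shift⁻ k) (triangles Θ))
      (sym (lookup-quiddity Θ v))
    touching : ∀ v → Incident (punchIn k v) (p , k , q) →
      lookup (quiddity Θ′) (punchIn k v) ≡ suc (lookup (quiddity Θ) v)
    touching v inc = trans (count (punchIn k v)) (trans
      (cong length (filter-accept (incident? (punchIn k v)) inc)) (cong suc (outerCount v)))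
    avoiding : ∀ v → ¬ Incident (punchIn k v) (p , k , q) →
      lookup (quiddity Θ′) (punchIn k v) ≡ lookup (quiddity Θ) v
    avoiding v ¬inc = trans (count (punchIn k v)) (trans
      (cong length (filter-reject (incident? (punchIn k v)) ¬inc)) (outerCount v))
    tip : lookup (quiddity Θ′) k ≡ 1
    tip = trans (count k) (trans
      (cong length (filter-accept (incident? k) {p , k , q} (inj₂ (inj₁ refl))))
      (cong (suc ∘ length) (filter-none (incident? k)
        (All.map⁺ (All.universal (λ Δ → hole-not-incident k) (triangles Θ))))))
    pointwise : ∀ v → lookup (quiddity Θ′) v ≡ lookup (insertEar i (quiddity Θ)) v
    pointwise v with punchView k v
    ... | hole = trans tip (sym (lookup-insertEar-tip i (quiddity Θ)))
    ... | kept u with u ≟ inject₁ i | u ≟ suc i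
    ...   | yes refl | _ = begin
      lookup (quiddity Θ′) (punchIn k u)      ≡⟨ touching u (inj₁ (punchIn-left i)) ⟩
      suc (lookup (quiddity Θ) u)             ≡⟨ lookup-insertEar-left i (quiddity Θ) ⟨
      lookup (insertEar i (quiddity Θ)) p     ≡⟨ cong (lookup (insertEar i (quiddity Θ))) (punchIn-left i) ⟨
      lookup (insertEar i (quiddity Θ)) (punchIn k u) ∎
    ...   | no _ | yes refl = begin
      lookup (quiddity Θ′) (punchIn k u)      ≡⟨ touching u (inj₂ (inj₂ (punchIn-right i))) ⟩
      suc (lookup (quiddity Θ) u)             ≡⟨ lookup-insertEar-right i (quiddity Θ) ⟨
      lookup (insertEar i (quiddity Θ)) q     ≡⟨ cong (lookup (insertEar i (quiddity Θ))) (punchIn-right i) ⟨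
      lookup (insertEar i (quiddity Θ)) (punchIn k u) ∎
    ...   | no u≢l | no u≢r = trans (avoiding u not-incident)
              (sym (lookup-insertEar-outer i (quiddity Θ) u u≢l u≢r))
      where
      not-incident : ¬ Incident (punchIn k u) (p , k , q)
      not-incident (inj₁ eq) = u≢l (punchIn-injective k _ _ (trans eq (sym (punchIn-left i))))
      not-incident (inj₂ (inj₁ eq)) = punchInᵢ≢i k u eq
      not-incident (inj₂ (inj₂ eq)) = u≢r (punchIn-injective k _ _ (trans eq (sym (punchIn-right i))))

toList-insertEar : ∀ {m} (i : Fin (suc m)) (t : Vec ℕ (2 + m)) →
  toList (insertEar i t) ≡ splice (toList t) (toℕ i) digon
toList-insertEar         zero    (a ∷ b ∷ t) =
  cong (_∷ 1 ∷ suc b ∷ toList t) (trans (ℕ.+-comm 1 a) (cong (_+ 1) (sym (ℕ.+-identityʳ a))))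
toList-insertEar {suc m} (suc i) (a ∷ t)     = cong (a ∷_) (toList-insertEar i t)

-- Ears are cut and glued on edge sets, whereas counts belong to triangulations; `triangulation`
-- links the two only up to `≐`.
IsEar-resp-≐ : ∀ {m} (i : Fin (suc m)) {E′ F′ E F} → E′ ≐ F′ → E ≐ F →
  Gap.IsEar i F′ F → Gap.IsEar i E′ E
IsEar-resp-≐ i e′ e ie = record
  { outer    = mk⇔ (from e′ ∘ to (Gap.outer ie) ∘ to e) (from e ∘ from (Gap.outer ie) ∘ to e′)
  ; from-tip = Gap.from-tip ie ∘ to e′
  ; to-tip   = Gap.to-tip ie ∘ to e′
  }
  where open Equivalence

-- Quiddity sequences are exactly the generated ones

quiddity-generated : ∀ {m} (Θ : Triangulation (2 + m)) → Generated (toList (quiddity Θ))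
-- No triple of two vertices is strictly increasing, so the counts evaluate to zero for every `Θ`.
quiddity-generated {zero}  Θ = base
quiddity-generated {suc m} Θ′ with i , pq ← hasEar (edgeSet Θ′)
  with E , ie ← Gap.cutEar i (edgeSet Θ′) pq
  with Θ , Θ≐E ← triangulation E =
  subst Generated
    (sym (trans (cong toList (quiddity-ear i {Θ′} {Θ} (IsEar-resp-≐ i (mk⇔ id id) Θ≐E ie)))
                (toList-insertEar i (quiddity Θ))))
    (ear (toℕ i) (subst (suc (toℕ i) ℕ.<_) (sym (length-toList (quiddity Θ))) (s≤s (toℕ<n i)))
      (quiddity-generated Θ))

digonTriangulation : Triangulation 2
digonTriangulation = record
  { diagonals = [] ; isDiagonal = λ () ; noncrossing = λ () ; maximal = mx }
  where
  mx : ∀ {e} → IsDiagonal e → (∀ {f} → f ∈ [] → ¬ Crosses e f) → e ∈ []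
  mx {zero     , suc zero} (_ , ¬s)      _ = contradiction (inj₁ refl) ¬s
  mx {_        , zero}     (() , _)      _
  mx {suc zero , suc zero} (s≤s () , _)  _

attachEar : ∀ {m} (i : Fin (suc m)) (Θ : Triangulation (2 + m)) →
  Σ[ Θ′ ∈ Triangulation (3 + m) ] quiddity Θ′ ≡ insertEar i (quiddity Θ)
attachEar i Θ with E′ , isEar ← Gap.glueEar i (edgeSet Θ)
  with Θ′ , Θ′≐E′ ← triangulation E′ =
  Θ′ , quiddity-ear i {Θ′} {Θ} (IsEar-resp-≐ i Θ′≐E′ (mk⇔ id id) isEar)

generated-triangulation : ∀ {l} → Generated l →
  ∃[ m ] Σ[ Θ ∈ Triangulation (2 + m) ] toList (quiddity Θ) ≡ l
generated-triangulation base = 0 , digonTriangulation , refl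
generated-triangulation (ear j j< g) with m , Θ , refl ← generated-triangulation g =
  suc m , Θ′ , (begin
    toList (quiddity Θ′)                        ≡⟨ cong toList (proj₂ (attachEar i Θ)) ⟩
    toList (insertEar i (quiddity Θ))           ≡⟨ toList-insertEar i (quiddity Θ) ⟩
    splice (toList (quiddity Θ)) (toℕ i) digon  ≡⟨ cong (λ k → splice (toList (quiddity Θ)) k digon) (toℕ-fromℕ< i<) ⟩
    splice (toList (quiddity Θ)) j digon        ∎)
  where
  i< : j ℕ.< suc m
  i< = ℕ.s≤s⁻¹ (subst (suc j ℕ.<_) (length-toList (quiddity Θ)) j<)
  i : Fin (suc m)
  i = fromℕ< i<
  Θ′ : Triangulation (3 + m)
  Θ′ = proj₁ (attachEar i Θ)

generated-quiddity : ∀ {m} (t : Vec ℕ (2 + m)) → Generated (toList t) →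
  Σ[ Θ ∈ Triangulation (2 + m) ] quiddity Θ ≡ t
generated-quiddity {m} t g with m′ , Θ , eq ← generated-triangulation g
  with refl ← ℕ.+-cancelˡ-≡ 2 m′ m
    (trans (sym (length-toList (quiddity Θ))) (trans (cong length eq) (length-toList t))) =
  Θ , trans (sym (cast-is-id refl (quiddity Θ))) (toList-injective refl (quiddity Θ) t eq)

-- From vectors to lists

toℕ-⊕ : ∀ {n m} (i : Fin (suc n)) (j : Fin (suc m)) → toℕ (i ⊕ j) ≡ toℕ i + toℕ j
toℕ-⊕ i j = toℕ-fromℕ< _

toℕ-next : ∀ {n} (i : Fin (suc n)) → toℕ (next i) ≡ suc (toℕ i) % suc n
toℕ-next i = toℕ-fromℕ< _

toList-incLast : ∀ {m} (s : Vec ℕ (suc m)) → toList (s [ fromℕ m ]%= suc) ≡ incLast (toList s)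
toList-incLast (a ∷ [])    = refl
toList-incLast (a ∷ b ∷ s) = cong (a ∷_) (toList-incLast (b ∷ s))

-- The parameter `f` serves two clauses of `graft`: `suc` with `b` zero for grafting the digon, and
-- adding the first entry plus one for longer sequences.
module _ {f : ℕ → ℕ} {b : ℕ} {s : List ℕ} (f-entry : ∀ a → f a ≡ a + b + 1) where

  toList-insertAfter-inner : ∀ {n m} (t : Vec ℕ (suc n)) (i j : Fin (suc n)) (ys : Vec ℕ m) →
    toℕ j ≡ suc (toℕ i) → toList ys ≡ incLast s →
    toList (insertAfter (t [ i ]%= f [ j ]%= suc) i ys) ≡ splice (toList t) (toℕ i) (b ∷ s)
  toList-insertAfter-inner (a ∷ []) zero zero ys () _
  toList-insertAfter-inner {suc n} {m} (a ∷ c ∷ t) zero (suc zero) ys _ ys≡ = begin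
    toList (cast (cong suc (ℕ.+-comm m (suc n))) (f a ∷ ys Vec.++ suc c ∷ t))
      ≡⟨ toList-cast (cong suc (ℕ.+-comm m (suc n))) (f a ∷ ys Vec.++ suc c ∷ t) ⟩
    f a ∷ toList (ys Vec.++ suc c ∷ t)           ≡⟨ cong₂ _∷_ (f-entry a) (toList-++ ys (suc c ∷ t)) ⟩
    a + b + 1 ∷ toList ys ++ suc c ∷ toList t ≡⟨ cong (λ u → a + b + 1 ∷ u ++ suc c ∷ toList t) ys≡ ⟩
    a + b + 1 ∷ incLast s ++ suc c ∷ toList t ∎
  toList-insertAfter-inner {suc n} (a ∷ t) (suc i) (suc j) ys j≡ ys≡ =
    cong (a ∷_) (toList-insertAfter-inner t i j ys (ℕ.suc-injective j≡) ys≡)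

  toList-insertAfter-last : ∀ {n m} (t : Vec ℕ (suc n)) (i : Fin (suc n)) (ys : Vec ℕ m) →
    toℕ i ≡ n → toList ys ≡ incLast s →
    toList (insertAfter (t [ i ]%= f) i ys) ≡ splice (toList t) (toℕ i) (b ∷ s)
  toList-insertAfter-last {m = m} (a ∷ []) zero ys _ ys≡ = begin
    toList (cast (cong suc (ℕ.+-comm m 0)) (f a ∷ ys Vec.++ []))
      ≡⟨ toList-cast (cong suc (ℕ.+-comm m 0)) (f a ∷ ys Vec.++ []) ⟩
    f a ∷ toList (ys Vec.++ [])            ≡⟨ cong₂ _∷_ (f-entry a) (toList-++ ys []) ⟩
    a + b + 1 ∷ toList ys ++ []       ≡⟨ cong (λ u → a + b + 1 ∷ u ++ []) ys≡ ⟩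
    a + b + 1 ∷ incLast s ++ []       ∎
  toList-insertAfter-last {suc n} (a ∷ t) (suc i) ys i≡ ys≡ =
    cong (a ∷_) (toList-insertAfter-last t i ys (ℕ.suc-injective i≡) ys≡)

  toList-insertAfter : ∀ {n m} (t : Vec ℕ (2 + n)) (i : Fin (2 + n)) (ys : Vec ℕ m) →
    toList ys ≡ incLast s →
    toList (insertAfter (t [ i ]%= f [ next i ]%= suc) i ys) ≡
    cyclicSplice (toList t) (toℕ i) (b ∷ s)
  toList-insertAfter {n} t i ys ys≡ with ℕ.m≤n⇒m<n∨m≡n (toℕ<n i)
  ... | inj₁ i< = trans
    (toList-insertAfter-inner t i (next i) ys (trans (toℕ-next i) (m<n⇒m%n≡m i<)) ys≡)
    (sym (cyclicSplice-inner (toList t) (toℕ i) _ (subst (suc (toℕ i) ℕ.<_) (sym (length-toList t)) i<)))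
  ... | inj₂ i≡ = trans (last t i i≡)
    (sym (cyclicSplice-last (toList t) (toℕ i) _ (trans i≡ (sym (length-toList t)))))
    where
    last : (t : Vec ℕ (2 + n)) (i : Fin (2 + n)) → suc (toℕ i) ≡ 2 + n →
      toList (insertAfter (t [ i ]%= f [ next i ]%= suc) i ys) ≡
      incHead (splice (toList t) (toℕ i) (b ∷ s))
    -- With at least two entries the last position is not the first, so the wrapped increment hits
    -- the head and leaves the contact entry alone.
    last (a ∷ t) i@(suc i′) i≡ = begin
      toList (insertAfter ((a ∷ t) [ i ]%= f [ next i ]%= suc) i ys)
        ≡⟨ cong (λ j → toList (insertAfter ((a ∷ t) [ i ]%= f [ j ]%= suc) i ys)) next≡0 ⟩
      suc a ∷ toList (insertAfter (t [ i′ ]%= f) i′ ys)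
        ≡⟨ cong (suc a ∷_) (toList-insertAfter-last t i′ ys (ℕ.suc-injective (ℕ.suc-injective i≡)) ys≡) ⟩
      incHead (splice (toList (a ∷ t)) (toℕ i) (b ∷ s)) ∎
      where
      next≡0 : next i ≡ zero
      next≡0 = toℕ-injective (trans (toℕ-next i) (trans (cong (_% (2 + n)) i≡) (n%n≡0 (2 + n))))

toℕ<length : ∀ {n} (t : Vec ℕ n) (i : Fin n) → toℕ i ℕ.< length (toList t)
toℕ<length t i = subst (toℕ i ℕ.<_) (sym (length-toList t)) (toℕ<n i)

-- Membership is available only irrelevantly; decidable equality of vectors recovers a usable proof.
digon-unique : {t : Vec ℕ 2} → .(IsQuiddity t) → t ≡ 0 ∷ 0 ∷ []
digon-unique {t} q = recompute (Vec.≡-dec ℕ._≟_ t (0 ∷ 0 ∷ [])) q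

monogon-unique : {t : Vec ℕ 1} → .(IsQuiddity t) → t ≡ 0 ∷ []
monogon-unique {t} q = recompute (Vec.≡-dec ℕ._≟_ t (0 ∷ [])) q

-- Membership enters because `graft` does not inspect an argument of arity 2, while `cyclicSplice`
-- reads its entries: they must be known to be zero.
toList-graft : ∀ {n m} (t : Vec ℕ (2 + n)) (i : Fin (2 + n)) (s : Vec ℕ (2 + m)) →
  .(IsQuiddity t) → .(IsQuiddity s) →
  toList (graft t i s) ≡ cyclicSplice (toList t) (toℕ i) (toList s)
toList-graft {zero} {zero} t i s p q with refl ← digon-unique {t} p | refl ← digon-unique {s} q with i
... | zero     = refl
... | suc zero = refl
toList-graft {zero} {suc m} t zero (a ∷ s) p q with refl ← digon-unique {t} p = begin
  toList ((suc a ∷ (s [ fromℕ (suc m) ]%= suc)) ∷ʳ 1)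
    ≡⟨ cong₂ _∷_ (ℕ.+-comm 1 a) (toList-∷ʳ 1 (s [ fromℕ (suc m) ]%= suc)) ⟩
  a + 1 ∷ toList (s [ fromℕ (suc m) ]%= suc) ++ 1 ∷ []
    ≡⟨ cong (λ u → a + 1 ∷ u ++ 1 ∷ []) (toList-incLast s) ⟩
  a + 1 ∷ incLast (toList s) ++ 1 ∷ [] ∎
toList-graft {zero} {suc m} t (suc zero) (a ∷ s) p q with refl ← digon-unique {t} p =
  cong (1 ∷_) (begin
    suc a ∷ toList (s [ fromℕ (suc m) ]%= suc)
      ≡⟨ cong₂ _∷_ (ℕ.+-comm 1 a) (toList-incLast s) ⟩
    a + 1 ∷ incLast (toList s)
      ≡⟨ cong (a + 1 ∷_) (++-identityʳ (incLast (toList s))) ⟨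
    a + 1 ∷ incLast (toList s) ++ [] ∎)
toList-graft {suc n} {zero}  t i s p q with refl ← digon-unique {s} q =
  toList-insertAfter (λ a → trans (ℕ.+-comm 1 a) (cong (_+ 1) (sym (ℕ.+-identityʳ a)))) t i (1 ∷ []) refl
toList-graft {suc n} {suc m} t i (a ∷ s) p q =
  toList-insertAfter (λ _ → refl) t i (s [ fromℕ (suc m) ]%= suc) (toList-incLast s)

toList-graft-monogon : ∀ {n} (t : Vec ℕ (2 + n)) i (s : Vec ℕ 1) → toList (graft t i s) ≡ toList t
toList-graft-monogon t i s = toList-cast _ t

isQuiddity⇒generated : ∀ {m} (t : Vec ℕ (2 + m)) → IsQuiddity t → Generated (toList t)
isQuiddity⇒generated {zero}  t refl       = base
isQuiddity⇒generated {suc m} t (Θ , refl) = quiddity-generated Θ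

generated⇒isQuiddity : ∀ {m} (t : Vec ℕ (2 + m)) → Generated (toList t) → IsQuiddity t
generated⇒isQuiddity {zero}  t g with Θ , refl ← generated-quiddity t g = refl
generated⇒isQuiddity {suc m} t g = generated-quiddity t g

-- The list determines the length, so arities that agree only propositionally are identified
-- together with the entries.
toList-cancel : ∀ {n m} (t : Vec ℕ n) (s : Vec ℕ m) → toList t ≡ toList s →
  _≡_ {A = Σ ℕ (Vec ℕ)} (n , t) (m , s)
toList-cancel t s eq
  with refl ← trans (sym (length-toList t)) (trans (cong length eq) (length-toList s))
  with refl ← trans (sym (cast-is-id refl t)) (toList-injective refl t s eq) = refl

-- Closure under grafting and the operad axioms

graft-closed : GraftClosed
graft-closed {zero} t i s p q = q
-- Grafting (0) is a cast to another arity, so membership is transported along an equality of pairs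
-- of arity and sequence.
graft-closed {suc n} {zero} t i s p q =
  subst (λ { (k , u) → IsQuiddity {k} u }) (toList-cancel t (graft t i s) (sym (toList-graft-monogon t i s))) p
graft-closed {suc n} {suc m} t i s p q = generated⇒isQuiddity (graft t i s)
  (subst Generated (sym (toList-graft t i s p q))
    (generated-cyclicSplice (toℕ i) (toℕ<length t i)
      (isQuiddity⇒generated t p) (isQuiddity⇒generated s q)))

QS-≡ : ∀ {n m} (x : QS n) (y : QS m) → toList (value x) ≡ toList (value y) →
  _≡_ {A = Σ ℕ QS} (n , x) (m , y)
QS-≡ (t , p) (s , q) eq with refl ← toList-cancel t s eq = refl

-- The sequence (0) is not generated from the digon, so `x` or `z` of arity 1 is handled directly;
-- `y` always has at least two entries.
graft-sequential : ∀ {n m k} (x : Vec ℕ (suc n)) (y : Vec ℕ (2 + m)) (z : Vec ℕ (suc k))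
  (i : Fin (suc n)) (j : Fin (suc m)) →
  .(IsQuiddity x) → .(IsQuiddity y) → .(IsQuiddity z) →
  toList (graft (graft x i y) (i ⊕ inject₁ j) z) ≡ toList (graft x i (graft y (inject₁ j) z))
graft-sequential {zero} x y z zero j _ _ _ =
  cong (λ l → toList (graft y l z)) (toℕ-injective (toℕ-⊕ {0} zero (inject₁ j)))
graft-sequential {suc n} {m} {zero} x y z i j p q r = begin
  toList (graft (graft x i y) (i ⊕ inject₁ j) z)
    ≡⟨ toList-graft-monogon (graft x i y) (i ⊕ inject₁ j) z ⟩
  toList (graft x i y)
    ≡⟨ toList-graft x i y p q ⟩
  cyclicSplice (toList x) (toℕ i) (toList y)
    ≡⟨ cong (cyclicSplice (toList x) (toℕ i)) (toList-graft-monogon y (inject₁ j) z) ⟨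
  cyclicSplice (toList x) (toℕ i) (toList (graft y (inject₁ j) z))
    ≡⟨ toList-graft x i (graft y (inject₁ j) z) p (graft-closed y (inject₁ j) z q r) ⟨
  toList (graft x i (graft y (inject₁ j) z)) ∎
graft-sequential {suc n} {m} {suc k} x y@(b ∷ y′) z i j p q r = begin
  toList (graft (graft x i y) (i ⊕ inject₁ j) z)
    ≡⟨ toList-graft (graft x i y) (i ⊕ inject₁ j) z (graft-closed x i y p q) r ⟩
  cyclicSplice (toList (graft x i y)) (toℕ (i ⊕ inject₁ j)) (toList z)
    ≡⟨ cong₂ (λ u l → cyclicSplice u l (toList z)) (toList-graft x i y p q)
         (trans (toℕ-⊕ i (inject₁ j)) (cong (toℕ i +_) (toℕ-inject₁ j))) ⟩
  cyclicSplice (cyclicSplice (toList x) (toℕ i) (toList y)) (toℕ i + toℕ j) (toList z)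
    ≡⟨ cyclicSplice-sequential (toList x) (toℕ i) b (toList y′) (toℕ j) (toList z)
         (toℕ<length x i) (toℕ<length y′ j) ⟩
  cyclicSplice (toList x) (toℕ i) (cyclicSplice (toList y) (toℕ j) (toList z))
    ≡⟨ cong (λ l → cyclicSplice (toList x) (toℕ i) (cyclicSplice (toList y) l (toList z))) (toℕ-inject₁ j) ⟨
  cyclicSplice (toList x) (toℕ i) (cyclicSplice (toList y) (toℕ (inject₁ j)) (toList z))
    ≡⟨ cong (cyclicSplice (toList x) (toℕ i)) (toList-graft y (inject₁ j) z q r) ⟨
  cyclicSplice (toList x) (toℕ i) (toList (graft y (inject₁ j) z))
    ≡⟨ toList-graft x i (graft y (inject₁ j) z) p (graft-closed y (inject₁ j) z q r) ⟨
  toList (graft x i (graft y (inject₁ j) z)) ∎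

-- Replaces a sequence by its graft with (0), whose arity is a different expression, so that
-- ordinary congruence does not apply.
graft-cong : ∀ {n n′ m} {x : Vec ℕ (2 + n)} {x′ : Vec ℕ (2 + n′)} {i i′} (y : Vec ℕ (2 + m)) →
  toList x ≡ toList x′ → toℕ i ≡ toℕ i′ → .(IsQuiddity x) → .(IsQuiddity x′) → .(IsQuiddity y) →
  toList (graft x i y) ≡ toList (graft x′ i′ y)
graft-cong {x = x} {x′} {i} {i′} y x≡ i≡ p p′ q = begin
  toList (graft x i y)                        ≡⟨ toList-graft x i y p q ⟩
  cyclicSplice (toList x) (toℕ i) (toList y)  ≡⟨ cong₂ (λ u l → cyclicSplice u l (toList y)) x≡ i≡ ⟩
  cyclicSplice (toList x′) (toℕ i′) (toList y) ≡⟨ toList-graft x′ i′ y p′ q ⟨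
  toList (graft x′ i′ y)                      ∎

toℕ-⊕-fromℕ : ∀ {n} m (j : Fin (suc n)) → toℕ (j ⊕ fromℕ m) ≡ toℕ j + m
toℕ-⊕-fromℕ m j = trans (toℕ-⊕ j (fromℕ m)) (cong (toℕ j +_) (toℕ-fromℕ m))

graft-parallel : ∀ {n m k} (x : Vec ℕ (suc n)) (y : Vec ℕ (suc m)) (z : Vec ℕ (suc k))
  (i j : Fin (suc n)) → i < j →
  .(IsQuiddity x) → .(IsQuiddity y) → .(IsQuiddity z) →
  toList (graft (graft x i y) (j ⊕ fromℕ m) z) ≡ toList (graft (graft x j z) (i ↑ˡ k) y)
graft-parallel {zero} x y z zero zero () _ _ _
graft-parallel {suc n} {zero} {zero} x y z i j _ _ _ _ = begin
  toList (graft (graft x i y) (j ⊕ fromℕ 0) z) ≡⟨ toList-graft-monogon (graft x i y) (j ⊕ fromℕ 0) z ⟩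
  toList (graft x i y)                         ≡⟨ toList-graft-monogon x i y ⟩
  toList x                                     ≡⟨ toList-graft-monogon x j z ⟨
  toList (graft x j z)                         ≡⟨ toList-graft-monogon (graft x j z) (i ↑ˡ 0) y ⟨
  toList (graft (graft x j z) (i ↑ˡ 0) y)      ∎
graft-parallel {suc n} {zero} {suc k} x y z i j _ p q r = begin
  toList (graft (graft x i y) (j ⊕ fromℕ 0) z)
    ≡⟨ graft-cong {x = graft x i y} {x} {j ⊕ fromℕ 0} {j} z (toList-graft-monogon x i y)
         (trans (toℕ-⊕-fromℕ 0 j) (ℕ.+-identityʳ _)) (graft-closed x i y p q) p r ⟩
  toList (graft x j z)
    ≡⟨ toList-graft-monogon (graft x j z) (i ↑ˡ suc k) y ⟨
  toList (graft (graft x j z) (i ↑ˡ suc k) y) ∎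
graft-parallel {suc n} {suc m} {zero} x y z i j _ p q r = begin
  toList (graft (graft x i y) (j ⊕ fromℕ (suc m)) z)
    ≡⟨ toList-graft-monogon (graft x i y) (j ⊕ fromℕ (suc m)) z ⟩
  toList (graft x i y)
    ≡⟨ graft-cong {x = graft x j z} {x} {i ↑ˡ 0} {i} y (toList-graft-monogon x j z)
         (toℕ-↑ˡ i 0) (graft-closed x j z p r) p q ⟨
  toList (graft (graft x j z) (i ↑ˡ 0) y) ∎
graft-parallel {suc n} {suc m} {suc k} x y@(b ∷ y′) z@(c ∷ z′) i j i<j p q r = begin
  toList (graft (graft x i y) (j ⊕ fromℕ (suc m)) z)
    ≡⟨ toList-graft (graft x i y) (j ⊕ fromℕ (suc m)) z (graft-closed x i y p q) r ⟩
  cyclicSplice (toList (graft x i y)) (toℕ (j ⊕ fromℕ (suc m))) (toList z)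
    ≡⟨ cong₂ (λ u l → cyclicSplice u l (toList z)) (toList-graft x i y p q)
         (trans (toℕ-⊕-fromℕ (suc m) j) (cong (toℕ j +_) (sym (length-toList y′)))) ⟩
  cyclicSplice (cyclicSplice (toList x) (toℕ i) (toList y)) (toℕ j + length (toList y′)) (toList z)
    ≡⟨ cyclicSplice-parallel (toList x) (toℕ i) (toℕ j) b (toList y′) c (toList z′) i<j (toℕ<length x j) ⟩
  cyclicSplice (cyclicSplice (toList x) (toℕ j) (toList z)) (toℕ i) (toList y)
    ≡⟨ cong₂ (λ u l → cyclicSplice u l (toList y)) (toList-graft x j z p r) (toℕ-↑ˡ i (suc k)) ⟨
  cyclicSplice (toList (graft x j z)) (toℕ (i ↑ˡ suc k)) (toList y)
    ≡⟨ toList-graft (graft x j z) (i ↑ˡ suc k) y (graft-closed x j z p r) q ⟨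
  toList (graft (graft x j z) (i ↑ˡ suc k) y) ∎

graft-identityʳ : ∀ {n} (x : Vec ℕ (suc n)) i → .(IsQuiddity x) →
  toList (graft x i (0 ∷ [])) ≡ toList x
graft-identityʳ {zero}  x i p = cong toList (sym (monogon-unique {x} p))
graft-identityʳ {suc n} x i p = toList-graft-monogon x i (0 ∷ [])

theorem3 : Σ[ closed ∈ GraftClosed ] IsQuiddityOperad QS (graftQS closed) 𝟏
theorem3 = graft-closed , record
  { sequential = λ { (x , [ p ]) (y , [ q ]) (z , [ r ]) i j →
                     QS-≡ _ _ (graft-sequential x y z i j p q r) }
  ; parallel   = λ { (x , [ p ]) (y , [ q ]) (z , [ r ]) i j i<j →
                     QS-≡ _ _ (graft-parallel x y z i j i<j p q r) }
  -- Grafting into (0) returns the second argument, the arities `0 + n` and `n` agree by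
  -- computation, and membership is irrelevant.
  ; identityˡ  = λ _ → refl
  ; identityʳ  = λ { (x , [ p ]) i → QS-≡ _ _ (graft-identityʳ x i p) }
  }
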